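{- Let $A$ and $B$ be disjoint finite sets of points in the plane with $|A|=|B|=n$ such that $A\cup B$ is not collinear. Then the bivisibility graph $\mathcal{B}(A,B)$ contains a non-crossing subgraph with at least $n+1$ edges.
   Context: For disjoint finite point sets $A,B$ in the plane, the bivisibility graph $\mathcal{B}(A,B)$ has vertex set $A\cup B$, where $v\in A$ and $w\in B$ are adjacent iff no point of $A\cup B$ lies in the open segment $vw$. Edges are drawn as straight segments; a subgraph is non-crossing if no two of its edges intersect except at a common endpoint. -}

module Defs where

open import Level using (Level; _⊔_) renaming (suc to lsuc)
open import Data.Nat using (ℕ)
open import Data.Fin using (Fin)
open import Data.Product using (_×_; _,_; ∃; proj₁; proj₂)
open import Data.Sum using (_⊎_; inj₁; inj₂)
open import Data.List using (List; length)
open import Data.List.Membership.Propositional using (_∈_)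
open import Data.List.Relation.Unary.Unique.Propositional using (Unique)
open import Relation.Nullary using (¬_)
open import Relation.Binary using (Rel; IsStrictTotalOrder)
open import Relation.Binary.PropositionalEquality using (_≡_; _≢_)
open import Algebra.Bundles using (CommutativeRing)

-- An ordered field (the real plane ℝ² is the instance of interest).
record OrderedField (c ℓ₁ ℓ₂ : Level) : Set (lsuc (c ⊔ ℓ₁ ⊔ ℓ₂)) where
  field
    commutativeRing : CommutativeRing c ℓ₁
  open CommutativeRing commutativeRing public
  infix 4 _<_
  field
    _<_                : Rel Carrier ℓ₂
    isStrictTotalOrder : IsStrictTotalOrder _≈_ _<_
    +-mono-<           : ∀ z {x y} → x < y → (x + z) < (y + z)
    *-pos              : ∀ {x y} → 0# < x → 0# < y → 0# < (x * y)
    0≉1                : ¬ (0# ≈ 1#)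
    inverse            : ∀ x → ¬ (x ≈ 0#) → ∃ λ y → (x * y) ≈ 1#

  _≤_ : Rel Carrier (ℓ₁ ⊔ ℓ₂)
  x ≤ y = (x < y) ⊎ (x ≈ y)

module Geometry {c ℓ₁ ℓ₂} (F : OrderedField c ℓ₁ ℓ₂) where
  open OrderedField F

  Point : Set c
  Point = Carrier × Carrier

  _≈p_ : Point → Point → Set ℓ₁
  p ≈p q = (proj₁ p ≈ proj₁ q) × (proj₂ p ≈ proj₂ q)

  orient : Point → Point → Point → Carrier
  orient (px , py) (qx , qy) (rx , ry) =
    ((qx - px) * (ry - py)) - ((qy - py) * (rx - px))

  -- dot product (q - p)·(r - q), positive iff q lies strictly between p,r
  -- (for q on the line pr, p ≉ r)
  betw : Point → Point → Point → Carrier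
  betw (px , py) (qx , qy) (rx , ry) =
    ((qx - px) * (rx - qx)) + ((qy - py) * (ry - qy))

  InOpenSeg : Point → Point → Point → Set (ℓ₁ ⊔ ℓ₂)
  InOpenSeg q p r = (orient p r q ≈ 0#) × (0# < betw p q r)

  InClosedSeg : Point → Point → Point → Set (ℓ₁ ⊔ ℓ₂)
  InClosedSeg q p r = (orient p r q ≈ 0#) × (0# ≤ betw p q r)

  module Bivis (n : ℕ) (A B : Fin n → Point) where

    V : Set
    V = Fin n ⊎ Fin n

    pt : V → Point
    pt (inj₁ i) = A i
    pt (inj₂ j) = B j

    Collinear : Set ℓ₁
    Collinear = ∀ u v w → orient (pt u) (pt v) (pt w) ≈ 0#

    Edge : Set
    Edge = Fin n × Fin n

    Adjacent : Edge → Set (ℓ₁ ⊔ ℓ₂)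
    Adjacent (i , j) = ∀ v → ¬ InOpenSeg (pt v) (A i) (B j)

    CommonEndpoint : Point → Edge → Edge → Set ℓ₁
    CommonEndpoint q (i , j) (i' , j') =
      ((i ≡ i') × (q ≈p A i)) ⊎ ((j ≡ j') × (q ≈p B j))

    NonCrossingPair : Edge → Edge → Set (c ⊔ ℓ₁ ⊔ ℓ₂)
    NonCrossingPair (i , j) (i' , j') = ∀ q →
      InClosedSeg q (A i) (B j) → InClosedSeg q (A i') (B j') →
      CommonEndpoint q (i , j) (i' , j')

    NonCrossingSubgraph : List Edge → Set (c ⊔ ℓ₁ ⊔ ℓ₂)
    NonCrossingSubgraph es =
      Unique es ×
      (∀ {e} → e ∈ es → Adjacent e) ×
      (∀ {e f} → e ∈ es → f ∈ es → e ≢ f → NonCrossingPair e f)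

{-# OPTIONS --safe #-}

-- By induction on the number of points, every non-collinear set U cut out of A ∪ B by a convex
-- region has more than min (|A ∩ U| , |B ∩ U|) non-crossing edges, provided that the minimum
-- is positive.
--
-- Suppose that a line cuts off a part P of U with equally many points of both colours, and let
-- yz be an inner common tangent of P and Q = U ∖ P with y ∈ P and z ∈ Q. Sets such as P ∪ {z}
-- and Q have hulls that meet in a single point, so their drawings can be united. One of the pairs
-- P ∪ {z} , Q and P , Q ∪ {y} and P ∖ {y} ∪ {z} , Q ∪ {y} always yields enough edges, even if P
-- or Q is collinear: adding the opposite end of the tangent makes a collinear part non-collinear.
--
-- To find P, take the lexicographically least point p of U and its neighbour q on the boundary,
-- the far end of a side of the convex hull. If p and q have different colours, a balanced part
-- is found at one end of that side. If p and q have the same colour and it is not the majority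
-- colour, sweeping the other points around p from q must balance the colours at some point.
-- If it is the majority colour, p can be omitted; when the rest is collinear, p sees all of it.
--
-- All separating lines are affine functionals; a lexicographic pair of functionals f , g
-- is replaced by K f + g with K large.
module Submission where

open import Defs
open import Level using (_⊔_)
open import Algebra.Bundles using (CommutativeRing)
open import Data.Bool using (Bool; true; false; not)
import Data.Bool.Properties as Bool
open import Data.Nat as ℕ using (ℕ; _≤_; zero; suc; z≤n; s≤s)
import Data.Nat.Properties as ℕₚ
open import Data.Fin as Fin using (Fin)
open import Data.Product using (Σ; ∃; _×_; _,_; proj₁; proj₂)
open import Data.Sum using (_⊎_; inj₁; inj₂; [_,_]′)
import Data.Sum.Properties as Sum
open import Data.Empty using (⊥; ⊥-elim)
open import Data.List using (List; []; _∷_; _++_; length; filter; map; cartesianProduct; allFin)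
import Data.List.Properties as Listₚ
open import Data.List.Membership.Propositional using (_∈_; _∉_)
open import Data.List.Membership.Propositional.Properties
open import Data.List.Relation.Unary.Any using (here; there)
open import Data.List.Relation.Unary.All as All using (All; []; _∷_)
open import Data.List.Relation.Unary.AllPairs as AllPairs using ([]; _∷_)
open import Data.List.Relation.Unary.Unique.Propositional using (Unique)
import Data.List.Relation.Unary.Unique.Propositional.Properties as Uniqueₚ
open import Data.List.Relation.Binary.Permutation.Propositional
  using (_↭_; prep; swap; ↭-refl; ↭-trans; ↭-sym; ↭⇒↭ₛ)
open import Data.List.Relation.Binary.Permutation.Propositional.Properties
  using (All-resp-↭; ∈-resp-↭; ↭-length; shift; ++⁺ˡ; ++⁺ʳ; ++-comm; ++-assoc)
import Data.List.Relation.Binary.Permutation.Setoid.Properties as PermₛProperties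
open import Function using (_∘_; id)
open import Function.Definitions using (Injective)
open import Relation.Nullary using (¬_; Dec; yes; no)
open import Relation.Nullary.Decidable using (_×-dec_; map′)
open import Relation.Unary using (Decidable)
open import Relation.Binary using (tri<; tri≈; tri>; IsStrictTotalOrder)
open import Relation.Binary.PropositionalEquality as ≡ using (_≡_; _≢_)

-- Ring identities with integer coefficients

-- For collinear sets the bound fails: if one colour precedes the other on a line, only one edge
-- exists. So every set handed to the induction hypothesis has to be non-collinear, and this
-- dictates the choice among the three pairs.
--
-- The count: let P have m+1 points of either colour and let the rarer colour of Q occur r+1 times,
-- so that m+r+3 edges are wanted. Each of the first two pairs, where it applies, yields
-- (m+2)+(r+2), one to spare. In the third, P without y keeps at least m points of either colour and
-- yields m+1 together with z, so that (m+1)+(r+2) is exact; for m = 0 the single edge of P takes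
-- its place.
--
-- The added end upsets the balance, so the induction cannot stay within sets that have equally many
-- points of both colours. The minimum of the two counts is a workable measure because splitting off
-- P lowers it by exactly m+1.
--
-- Edges must be visible in all of A ∪ B, not only in the part. Convexity provides this: whatever
-- blocks a bichromatic segment of a part belongs to the part.

module IntegerCoefficients {c ℓ} (R : CommutativeRing c ℓ) where
  open CommutativeRing R hiding (zero)
  open import Algebra.Properties.Ring ring
  open import Algebra.Properties.AbelianGroup +-abelianGroup using (⁻¹-∙-comm)
  open import Algebra.Properties.Semiring.Mult semiring renaming (_×_ to _·_)
  open import Relation.Binary.Reasoning.Setoid setoid
  open import Tactic.RingSolver.Core.AlmostCommutativeRing using (_-Raw-AlmostCommutative⟶_; fromCommutativeRing)
  open import Tactic.RingSolver.Core.Polynomial.Parameters using (Homomorphism)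
  import Data.Vec as Vec
  open import Data.Vec.N-ary
  open import Data.Integer as ℤ using (ℤ; +_; -[1+_]; _⊖_)
  import Data.Integer.Properties as ℤₚ
  open import Data.Bool using (T)
  open import Data.Maybe using (nothing)

  ⟦_⟧ℤ : ℤ → Carrier
  ⟦ + n ⟧ℤ = n · 1#
  ⟦ -[1+ n ] ⟧ℤ = - (suc n · 1#)

  ⟦⟧-reflexive : ∀ {i j} → i ≡.≡ j → ⟦ i ⟧ℤ ≈ ⟦ j ⟧ℤ
  ⟦⟧-reflexive ≡.refl = refl

  neg-homo : ∀ i → ⟦ ℤ.- i ⟧ℤ ≈ - ⟦ i ⟧ℤ
  neg-homo (+ zero) = sym -0#≈0#
  neg-homo (+ suc n) = refl
  neg-homo -[1+ n ] = sym (-‿involutive _)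

  ⊖-homo : ∀ m n → ⟦ m ⊖ n ⟧ℤ ≈ m · 1# + - (n · 1#)
  ⊖-homo m zero = sym (trans (+-congˡ -0#≈0#) (+-identityʳ _))
  ⊖-homo zero (suc n) = sym (+-identityˡ _)
  ⊖-homo (suc m) (suc n) = begin
    ⟦ suc m ⊖ suc n ⟧ℤ                          ≈⟨ ⟦⟧-reflexive (ℤₚ.[1+m]⊖[1+n]≡m⊖n m n) ⟩
    ⟦ m ⊖ n ⟧ℤ                                  ≈⟨ ⊖-homo m n ⟩
    m · 1# + - (n · 1#)                         ≈⟨ +-congʳ (+-identityʳ _) ⟨
    (m · 1# + 0#) + - (n · 1#)                  ≈⟨ +-congʳ (+-congˡ (-‿inverseʳ 1#)) ⟨
    (m · 1# + (1# + - 1#)) + - (n · 1#)         ≈⟨ +-congʳ (+-assoc _ _ _) ⟨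
    ((m · 1# + 1#) + - 1#) + - (n · 1#)         ≈⟨ +-assoc _ _ _ ⟩
    (m · 1# + 1#) + (- 1# + - (n · 1#))         ≈⟨ +-cong (+-comm _ _) (⁻¹-∙-comm _ _) ⟩
    suc m · 1# + - (suc n · 1#)                 ∎

  +-homo : ∀ i j → ⟦ i ℤ.+ j ⟧ℤ ≈ ⟦ i ⟧ℤ + ⟦ j ⟧ℤ
  +-homo (+ m) (+ n) = ×-homo-+ 1# m n
  +-homo (+ m) -[1+ n ] = ⊖-homo m (suc n)
  +-homo -[1+ m ] (+ n) = trans (⊖-homo n (suc m)) (+-comm _ _)
  +-homo -[1+ m ] -[1+ n ] = begin
    ⟦ -[1+ m ] ℤ.+ -[1+ n ] ⟧ℤ                  ≈⟨ ⟦⟧-reflexive (ℤₚ.neg-distrib-+ (+ suc m) (+ suc n)) ⟨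
    ⟦ ℤ.- (+ (suc m ℕ.+ suc n)) ⟧ℤ              ≈⟨ neg-homo (+ (suc m ℕ.+ suc n)) ⟩
    - ((suc m ℕ.+ suc n) · 1#)                  ≈⟨ -‿cong (×-homo-+ 1# (suc m) (suc n)) ⟩
    - (suc m · 1# + suc n · 1#)                 ≈⟨ ⁻¹-∙-comm _ _ ⟨
    ⟦ -[1+ m ] ⟧ℤ + ⟦ -[1+ n ] ⟧ℤ               ∎

  *-homo⁺ : ∀ m j → ⟦ + m ℤ.* j ⟧ℤ ≈ ⟦ + m ⟧ℤ * ⟦ j ⟧ℤ
  *-homo⁺ m (+ n) = trans (⟦⟧-reflexive (≡.sym (ℤₚ.pos-* m n))) (×1-homo-* m n)
  *-homo⁺ m -[1+ n ] = begin
    ⟦ + m ℤ.* -[1+ n ] ⟧ℤ                       ≈⟨ ⟦⟧-reflexive (ℤₚ.neg-distribʳ-* (+ m) (+ suc n)) ⟨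
    ⟦ ℤ.- (+ m ℤ.* + suc n) ⟧ℤ                  ≈⟨ neg-homo (+ m ℤ.* + suc n) ⟩
    - ⟦ + m ℤ.* + suc n ⟧ℤ                      ≈⟨ -‿cong (*-homo⁺ m (+ suc n)) ⟩
    - (⟦ + m ⟧ℤ * ⟦ + suc n ⟧ℤ)                 ≈⟨ -‿distribʳ-* _ _ ⟩
    ⟦ + m ⟧ℤ * ⟦ -[1+ n ] ⟧ℤ                    ∎

  *-homo : ∀ i j → ⟦ i ℤ.* j ⟧ℤ ≈ ⟦ i ⟧ℤ * ⟦ j ⟧ℤ
  *-homo (+ m) j = *-homo⁺ m j
  *-homo -[1+ m ] j = begin
    ⟦ -[1+ m ] ℤ.* j ⟧ℤ                         ≈⟨ ⟦⟧-reflexive (ℤₚ.neg-distribˡ-* (+ suc m) j) ⟨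
    ⟦ ℤ.- (+ suc m ℤ.* j) ⟧ℤ                    ≈⟨ neg-homo (+ suc m ℤ.* j) ⟩
    - ⟦ + suc m ℤ.* j ⟧ℤ                        ≈⟨ -‿cong (*-homo⁺ (suc m) j) ⟩
    - (⟦ + suc m ⟧ℤ * ⟦ j ⟧ℤ)                   ≈⟨ -‿distribˡ-* _ _ ⟩
    ⟦ -[1+ m ] ⟧ℤ * ⟦ j ⟧ℤ                      ∎

  morphism : ℤ.+-*-rawRing -Raw-AlmostCommutative⟶ fromCommutativeRing R (λ _ → nothing)
  morphism = record
    { ⟦_⟧ = ⟦_⟧ℤ ; +-homo = +-homo ; *-homo = *-homo
    ; -‿homo = neg-homo ; 0-homo = refl ; 1-homo = +-identityʳ 1# }

  -- Cancellation has to be seen in the integer coefficients, because a test for zero in the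
  -- abstract ring does not compute.
  isZero : ℤ → Bool
  isZero (+ zero) = true
  isZero _ = false

  isZero⇒≈0 : ∀ i → T (isZero i) → 0# ≈ ⟦ i ⟧ℤ
  isZero⇒≈0 (+ zero) _ = refl

  homomorphism : Homomorphism _ _ _ _
  homomorphism = record
    { from = record { rawRing = ℤ.+-*-rawRing ; isZero = isZero }
    ; to = fromCommutativeRing R (λ _ → nothing)
    ; morphism = morphism
    ; Zero-C⟶Zero-R = isZero⇒≈0
    }

  open import Tactic.RingSolver.Core.Expression
  open import Tactic.RingSolver.Core.Polynomial.Base (Homomorphism.from homomorphism)
    using (Poly; Zero; Κ; ⅀; _⊐_; κ; ι; _⊞_; _⊠_; ⊟_; _⊡_)
  open import Tactic.RingSolver.Core.Polynomial.Semantics homomorphism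
    renaming (⟦_⟧ to ⟦_⟧ₚ)
  open import Tactic.RingSolver.Core.Polynomial.Homomorphism homomorphism
  open import Algebra.Properties.Semiring.Exp.TCOptimised semiring using (^-congˡ)
  open Eval rawRing ⟦_⟧ℤ

  Polynomial : ℕ → Set
  Polynomial = Expr ℤ

  infix  4 _:=_
  infixl 6 _:+_ _:-_
  infixl 7 _:*_
  infix  8 :-_

  _:+_ _:*_ _:-_ : ∀ {n} → Polynomial n → Polynomial n → Polynomial n
  _:+_ = _⊕_
  _:*_ = _⊗_
  p :- q = p ⊕ ⊝ q

  :-_ : ∀ {n} → Polynomial n → Polynomial n
  :-_ = ⊝_

  con : ∀ {n} → ℤ → Polynomial n
  con = Κ

  _:=_ : ∀ {n} → Polynomial n → Polynomial n → Polynomial n × Polynomial n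
  _:=_ = _,_

  norm : ∀ {n} → Polynomial n → Poly n
  norm (Κ x)   = κ x
  norm (Ι x)   = ι x
  norm (x ⊕ y) = norm x ⊞ norm y
  norm (x ⊗ y) = norm x ⊠ norm y
  norm (⊝ x)   = ⊟ norm x
  norm (x ⊛ i) = norm x ⊡ i

  norm-correct : ∀ {n} (e : Polynomial n) ρ → ⟦ norm e ⟧ₚ ρ ≈ ⟦ e ⟧ ρ
  norm-correct (Κ x)   ρ = κ-hom x ρ
  norm-correct (Ι x)   ρ = ι-hom x ρ
  norm-correct (x ⊕ y) ρ = trans (⊞-hom (norm x) (norm y) ρ) (+-cong (norm-correct x ρ) (norm-correct y ρ))
  norm-correct (x ⊗ y) ρ = trans (⊠-hom (norm x) (norm y) ρ) (*-cong (norm-correct x ρ) (norm-correct y ρ))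
  norm-correct (⊝ x)   ρ = trans (⊟-hom (norm x) ρ) (-‿cong (norm-correct x ρ))
  norm-correct (x ⊛ i) ρ = trans (⊡-hom (norm x) i ρ) (^-congˡ i (norm-correct x ρ))

  zero-sound : ∀ {n} (p : Poly n) ρ → Zero p → ⟦ p ⟧ₚ ρ ≈ 0#
  zero-sound (Κ x ⊐ _) ρ z = sym (isZero⇒≈0 x z)

  -- Only the difference of both sides is normalised, so that no terms of the
  -- abstract ring have to be compared.
  sound : ∀ {n} (e f : Polynomial n) → Zero (norm (e :- f)) → ∀ ρ → ⟦ e ⟧ ρ ≈ ⟦ f ⟧ ρ
  sound e f z ρ = x∙y⁻¹≈ε⇒x≈y _ _ (trans (sym (norm-correct (e :- f) ρ)) (zero-sound (norm (e :- f)) ρ z))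

  module _ (n : ℕ) (f : N-ary n (Polynomial n) (Polynomial n × Polynomial n)) where
    equation : Polynomial n × Polynomial n
    equation = f $ⁿ Vec.map Ι (Vec.allFin n)

    -- For a true identity the hidden argument evaluates to the unit type and is filled in by eta,
    -- so that callers supply only the equation.
    solve : {Zero (norm (proj₁ equation :- proj₂ equation))} →
            Eq n _≈_ (curryⁿ ⟦ proj₁ equation ⟧) (curryⁿ ⟦ proj₂ equation ⟧)
    solve {z} = curryⁿ-cong _≈_ ⟦ proj₁ equation ⟧ ⟦ proj₂ equation ⟧
      (sound (proj₁ equation) (proj₂ equation) z)

-- Signs in an ordered field

module Positivity {c ℓ₁ ℓ₂} (F : OrderedField c ℓ₁ ℓ₂) where
  open OrderedField F hiding (zero)
  open IntegerCoefficients commutativeRing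
    using (solve; con; _:=_; _:+_; _:*_; _:-_; :-_)
  private module < = IsStrictTotalOrder isStrictTotalOrder
  open import Data.Integer using (+_)

  Pos NonNeg : Carrier → Set _
  Pos x = 0# < x
  NonNeg x = Pos x ⊎ x ≈ 0#

  data Sign (x : Carrier) : Set (ℓ₁ ⊔ ℓ₂) where
    pos  : Pos x → Sign x
    zer  : x ≈ 0# → Sign x
    neg  : Pos (- x) → Sign x

  _≈0? : ∀ x → Dec (x ≈ 0#)
  x ≈0? = x <.≟ 0#

  pos-resp : ∀ {x y} → x ≈ y → Pos x → Pos y
  pos-resp = <.<-respʳ-≈

  nonNeg-resp : ∀ {x y} → x ≈ y → NonNeg x → NonNeg y
  nonNeg-resp e (inj₁ p) = inj₁ (pos-resp e p)
  nonNeg-resp e (inj₂ z) = inj₂ (trans (sym e) z)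

  pos⇒≉0 : ∀ {x} → Pos x → ¬ x ≈ 0#
  pos⇒≉0 p z = <.irrefl (sym z) p

  pos-+ : ∀ {x y} → Pos x → Pos y → Pos (x + y)
  pos-+ {x} {y} p q = <.trans q (<.<-respˡ-≈ (+-identityˡ y) (+-mono-< y p))

  pos-neg : ∀ {x} → Pos x → ¬ Pos (- x)
  pos-neg p q = pos⇒≉0 (pos-+ p q) (-‿inverseʳ _)

  sign : ∀ x → Sign x
  sign x with <.compare 0# x
  ... | tri< p _ _ = pos p
  ... | tri≈ _ z _ = zer (sym z)
  ... | tri> _ _ n = neg (<.<-respˡ-≈ (-‿inverseʳ x) (<.<-respʳ-≈ (+-identityˡ (- x)) (+-mono-< (- x) n)))

  nonNeg? : ∀ x → NonNeg x ⊎ Pos (- x)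
  nonNeg? x with sign x
  ... | pos p = inj₁ (inj₁ p)
  ... | zer z = inj₁ (inj₂ z)
  ... | neg n = inj₂ n

  pos⇒¬neg-nonNeg : ∀ {x} → Pos x → ¬ NonNeg (- x)
  pos⇒¬neg-nonNeg p (inj₁ n) = pos-neg p n
  pos⇒¬neg-nonNeg p (inj₂ z) = pos⇒≉0 p (trans (sym (solve 1 (λ x → :- (:- x) := x) _)) (trans (-‿cong z) (solve 0 (:- con (+ 0) := con (+ 0)))))

  neg-swap : ∀ x y → - (x - y) ≈ y - x
  neg-swap = solve 2 (λ x y → :- (x :- y) := y :- x)

  -zero : ∀ {x} → x ≈ 0# → - x ≈ 0#
  -zero z = trans (-‿cong z) (solve 0 (:- con (+ 0) := con (+ 0)))

  zero-+ : ∀ {x y} → x ≈ 0# → y ≈ 0# → x + y ≈ 0#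
  zero-+ a b = trans (+-cong a b) (+-identityˡ _)

  zero-*ˡ : ∀ {x} y → x ≈ 0# → x * y ≈ 0#
  zero-*ˡ y z = trans (*-congʳ z) (zeroˡ y)

  zero-*ʳ : ∀ x {y} → y ≈ 0# → x * y ≈ 0#
  zero-*ʳ x z = trans (*-congˡ z) (zeroʳ x)

  pos-+-nonNeg : ∀ {x y} → Pos x → NonNeg y → Pos (x + y)
  pos-+-nonNeg p (inj₁ q) = pos-+ p q
  pos-+-nonNeg p (inj₂ z) = pos-resp (sym (trans (+-congˡ z) (+-identityʳ _))) p

  nonNeg-+ : ∀ {x y} → NonNeg x → NonNeg y → NonNeg (x + y)
  nonNeg-+ (inj₁ p) n = inj₁ (pos-+-nonNeg p n)
  nonNeg-+ (inj₂ z) n = nonNeg-resp (sym (trans (+-congʳ z) (+-identityˡ _))) n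

  nonNeg-* : ∀ {x y} → NonNeg x → NonNeg y → NonNeg (x * y)
  nonNeg-* (inj₁ p) (inj₁ q) = inj₁ (*-pos p q)
  nonNeg-* (inj₁ p) (inj₂ z) = inj₂ (zero-*ʳ _ z)
  nonNeg-* (inj₂ z) _ = inj₂ (zero-*ˡ _ z)

  neg*neg : ∀ {x} → Pos (- x) → Pos (x * x)
  neg*neg n = pos-resp (solve 1 (λ x → (:- x) :* (:- x) := x :* x) _) (*-pos n n)

  square-pos : ∀ {x} → ¬ x ≈ 0# → Pos (x * x)
  square-pos {x} x≉0 with sign x
  ... | pos p = *-pos p p
  ... | zer z = ⊥-elim (x≉0 z)
  ... | neg n = neg*neg n

  square-nonNeg : ∀ x → NonNeg (x * x)
  square-nonNeg x with x ≈0?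
  ... | yes z = inj₂ (zero-*ˡ x z)
  ... | no x≉0 = inj₁ (square-pos x≉0)

  pos-1 : Pos 1#
  pos-1 = pos-resp (*-identityˡ 1#) (square-pos (λ z → 0≉1 (sym z)))

  *-neg : ∀ x y → - (x * y) ≈ x * - y
  *-neg = solve 2 (λ x y → :- (x :* y) := x :* (:- y))

  pos-cancel : ∀ {d x} → Pos d → Pos (d * x) → Pos x
  pos-cancel {d} {x} pd p with sign x
  ... | pos q = q
  ... | zer z = ⊥-elim (pos⇒≉0 p (zero-*ʳ d z))
  ... | neg n = ⊥-elim (pos-neg p (pos-resp (sym (*-neg d x)) (*-pos pd n)))

  zero-cancel : ∀ {d x} → Pos d → d * x ≈ 0# → x ≈ 0#
  zero-cancel {d} {x} pd e with sign x
  ... | pos q = ⊥-elim (pos⇒≉0 (*-pos pd q) e)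
  ... | zer z = z
  ... | neg n = ⊥-elim (pos⇒≉0 (*-pos pd n) (trans (sym (*-neg d x)) (-zero e)))

  nonNeg-cancel : ∀ {d x} → Pos d → NonNeg (d * x) → NonNeg x
  nonNeg-cancel pd (inj₁ p) = inj₁ (pos-cancel pd p)
  nonNeg-cancel pd (inj₂ z) = inj₂ (zero-cancel pd z)

  -- if s were negative, s + t > 0 would force t > 0 and s t < 0.
  nonNeg-factorˡ : ∀ {s t} → Pos (s + t) → NonNeg (s * t) → NonNeg s
  nonNeg-factorˡ {s} {t} p st with nonNeg? s
  ... | inj₁ n = n
  ... | inj₂ n = ⊥-elim (pos⇒¬neg-nonNeg (*-pos n pos-t)
                  (nonNeg-resp (solve 2 (λ s t → s :* t := :- ((:- s) :* t)) s t) st))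
    where
    pos-t : Pos t
    pos-t = pos-resp (solve 2 (λ s t → (s :+ t) :+ (:- s) := t) s t) (pos-+ p n)

  nonNeg-total : ∀ x y → NonNeg (x - y) ⊎ NonNeg (y - x)
  nonNeg-total x y with nonNeg? (x - y)
  ... | inj₁ n = inj₁ n
  ... | inj₂ n = inj₂ (inj₁ (pos-resp (neg-swap x y) n))

  nonNeg-trans : ∀ {x y z} → NonNeg (x - y) → NonNeg (y - z) → NonNeg (x - z)
  nonNeg-trans {x} {y} {z} p q = nonNeg-resp
    (solve 3 (λ x y z → (x :- y) :+ (y :- z) := x :- z) x y z) (nonNeg-+ p q)

-- Affine geometry of the plane

module Plane {c ℓ₁ ℓ₂} (F : OrderedField c ℓ₁ ℓ₂) where
  open OrderedField F hiding (zero)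
  open Geometry F
  open Positivity F
  open IntegerCoefficients commutativeRing
    using (Polynomial; solve; con; _:=_; _:+_; _:*_; _:-_; :-_)
  open import Data.Integer using (+_)
  open import Relation.Binary.Reasoning.Setoid setoid

  private
    -- Symbolic copies of the geometric expressions let identities be stated in terms of points and
    -- vectors instead of expanded coordinates.
    Pt : ℕ → Set
    Pt n = Polynomial n × Polynomial n

    :vec : ∀ {n} → Pt n → Pt n → Pt n
    :vec (px , py) (qx , qy) = qx :- px , qy :- py

    :cross :dot : ∀ {n} → Pt n → Pt n → Polynomial n
    :cross (ux , uy) (vx , vy) = ux :* vy :- uy :* vx
    :dot (ux , uy) (vx , vy) = ux :* vx :+ uy :* vy

    :orient :betw : ∀ {n} → Pt n → Pt n → Pt n → Polynomial n
    :orient p q r = :cross (:vec p q) (:vec p r)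
    :betw p q r = :dot (:vec p q) (:vec q r)

  vec : Point → Point → Point
  vec (px , py) (qx , qy) = qx - px , qy - py

  cross dot : Point → Point → Carrier
  cross (ux , uy) (vx , vy) = ux * vy - uy * vx
  dot (ux , uy) (vx , vy) = ux * vx + uy * vy

  dist² : Point → Point → Carrier
  dist² p q = dot (vec p q) (vec p q)

  ≈p-sym : ∀ {p q} → p ≈p q → q ≈p p
  ≈p-sym (a , b) = sym a , sym b

  ≈p-trans : ∀ {p q r} → p ≈p q → q ≈p r → p ≈p r
  ≈p-trans (a , b) (a' , b') = trans a a' , trans b b'

  x-y≈0⇒x≈y : ∀ {x y} → x - y ≈ 0# → x ≈ y
  x-y≈0⇒x≈y {x} {y} e = begin
    x             ≈⟨ solve 2 (λ x y → x := (x :- y) :+ y) x y ⟩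
    (x - y) + y   ≈⟨ +-congʳ e ⟩
    0# + y        ≈⟨ +-identityˡ y ⟩
    y             ∎

  x≈y⇒x-y≈0 : ∀ {x y} → x ≈ y → x - y ≈ 0#
  x≈y⇒x-y≈0 e = trans (+-congʳ e) (-‿inverseʳ _)

  dist²-pos : ∀ {p q} → ¬ p ≈p q → Pos (dist² p q)
  dist²-pos {px , py} {qx , qy} p≉q with (qx - px) ≈0?
  ... | no dx≉0 = pos-+-nonNeg (square-pos dx≉0) (square-nonNeg _)
  ... | yes dx≈0 with (qy - py) ≈0?
  ...   | yes dy≈0 = ⊥-elim (p≉q (sym (x-y≈0⇒x≈y dx≈0) , sym (x-y≈0⇒x≈y dy≈0)))
  ...   | no dy≉0 = pos-resp (+-comm _ _) (pos-+-nonNeg (square-pos dy≉0) (square-nonNeg _))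

  orient-swap₂₃ : ∀ p q r → orient p r q ≈ - orient p q r
  orient-swap₂₃ (px , py) (qx , qy) (rx , ry) = solve 6
    (λ px py qx qy rx ry → let p = px , py ; q = qx , qy ; r = rx , ry in
      :orient p r q := :- :orient p q r) px py qx qy rx ry

  orient-cycle : ∀ p q r → orient q r p ≈ orient p q r
  orient-cycle (px , py) (qx , qy) (rx , ry) = solve 6
    (λ px py qx qy rx ry → let p = px , py ; q = qx , qy ; r = rx , ry in
      :orient q r p := :orient p q r) px py qx qy rx ry

  orient-ppq : ∀ p q → orient p p q ≈ 0#
  orient-ppq (px , py) (qx , qy) = solve 4
    (λ px py qx qy → let p = px , py ; q = qx , qy in
      :orient p p q := con (+ 0)) px py qx qy

  orient-pqq : ∀ p q → orient p q q ≈ 0#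
  orient-pqq p q = trans (orient-cycle q p q) (trans (orient-cycle q q p) (orient-ppq q p))

  orient-pqp : ∀ p q → orient p q p ≈ 0#
  orient-pqp p q = trans (orient-swap₂₃ p p q) (-zero (orient-ppq p q))

  betw-pqq : ∀ p q → betw p q q ≈ 0#
  betw-pqq (px , py) (qx , qy) = solve 4
    (λ px py qx qy → let p = px , py ; q = qx , qy in
      :betw p q q := con (+ 0)) px py qx qy

  betw-ppq : ∀ p q → betw p p q ≈ 0#
  betw-ppq (px , py) (qx , qy) = solve 4
    (λ px py qx qy → let p = px , py ; q = qx , qy in
      :betw p p q := con (+ 0)) px py qx qy

  -- Multiplied by |y₁y₂|², the vector vec y₁ u is expressed by its dot and cross
  -- product with vec y₁ y₂.
  collinear-line : ∀ {y₁ y₂ u v w} → ¬ y₁ ≈p y₂ →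
    orient y₁ y₂ u ≈ 0# → orient y₁ y₂ v ≈ 0# → orient y₁ y₂ w ≈ 0# → orient u v w ≈ 0#
  collinear-line {y₁@(ax , ay)} {y₂@(bx , by)} {u@(ux , uy)} {v@(vx , vy)} {w@(wx , wy)} y₁≉y₂ zu zv zw =
    zero-cancel (dist²-pos y₁≉y₂) (trans identity
      (zero-+ (zero-+ (zero-*ˡ _ zv) (zero-*ˡ _ zu)) (zero-*ˡ _ zw)))
    where
    e = vec y₁ y₂
    identity : dist² y₁ y₂ * orient u v w ≈
      orient y₁ y₂ v * dot e (vec w u) + orient y₁ y₂ u * dot e (vec v w) + orient y₁ y₂ w * dot e (vec u v)
    identity = solve 10 (λ ax ay bx by ux uy vx vy wx wy →
      let a = ax , ay ; b = bx , by ; u = ux , uy ; v = vx , vy ; w = wx , wy ; e = :vec a b in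
      :dot e e :* :orient u v w :=
      :orient a b v :* :dot e (:vec w u) :+ :orient a b u :* :dot e (:vec v w) :+ :orient a b w :* :dot e (:vec u v))
      ax ay bx by ux uy vx vy wx wy

  -- Affine functionals and convex combinations

  record Affine : Set c where
    constructor affine
    field α β γ : Carrier
  open Affine

  infixl 8 _⟨$⟩_
  _⟨$⟩_ : Affine → Point → Carrier
  h ⟨$⟩ (x , y) = α h * x + β h * y + γ h

  linear : Affine → Point → Carrier
  linear h (x , y) = α h * x + β h * y

  linear-vec : ∀ h p q → linear h (vec p q) ≈ h ⟨$⟩ q - h ⟨$⟩ p
  linear-vec h (px , py) (qx , qy) = solve 7 (λ a b c px py qx qy →
    a :* (qx :- px) :+ b :* (qy :- py) := (a :* qx :+ b :* qy :+ c) :- (a :* px :+ b :* py :+ c))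
    (α h) (β h) (γ h) px py qx qy

  ⟨$⟩-cong : ∀ h {p q} → p ≈p q → h ⟨$⟩ p ≈ h ⟨$⟩ q
  ⟨$⟩-cong h (a , b) = +-congʳ (+-cong (*-congˡ a) (*-congˡ b))

  negate : Affine → Affine
  negate (affine a b c) = affine (- a) (- b) (- c)

  negate-⟨$⟩ : ∀ h p → negate h ⟨$⟩ p ≈ - (h ⟨$⟩ p)
  negate-⟨$⟩ (affine a b c) (x , y) = solve 5 (λ a b c x y →
    (:- a) :* x :+ (:- b) :* y :+ (:- c) := :- (a :* x :+ b :* y :+ c)) a b c x y

  constant : Carrier → Affine
  constant c = affine 0# 0# c

  constant-⟨$⟩ : ∀ c p → constant c ⟨$⟩ p ≈ c
  constant-⟨$⟩ c (x , y) = solve 3 (λ c x y →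
    con (+ 0) :* x :+ con (+ 0) :* y :+ c := c) c x y

  infixl 7 _∔_
  _∔_ : Affine → Affine → Affine
  affine a b c ∔ affine a' b' c' = affine (a + a') (b + b') (c + c')

  ∔-⟨$⟩ : ∀ h k p → (h ∔ k) ⟨$⟩ p ≈ h ⟨$⟩ p + k ⟨$⟩ p
  ∔-⟨$⟩ (affine a b c) (affine a' b' c') (x , y) = solve 8 (λ a b c a' b' c' x y →
    (a :+ a') :* x :+ (b :+ b') :* y :+ (c :+ c') := (a :* x :+ b :* y :+ c) :+ (a' :* x :+ b' :* y :+ c'))
    a b c a' b' c' x y

  scale : Carrier → Affine → Affine
  scale k (affine a b c) = affine (k * a) (k * b) (k * c)

  scale-⟨$⟩ : ∀ k h p → scale k h ⟨$⟩ p ≈ k * (h ⟨$⟩ p)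
  scale-⟨$⟩ k (affine a b c) (x , y) = solve 6 (λ k a b c x y →
    (k :* a) :* x :+ (k :* b) :* y :+ (k :* c) := k :* (a :* x :+ b :* y :+ c)) k a b c x y

  through : Point → Point → Affine
  through (px , py) (qx , qy) = affine (py - qy) (qx - px) ((qy - py) * px - (qx - px) * py)

  through-⟨$⟩ : ∀ p q r → through p q ⟨$⟩ r ≈ orient p q r
  through-⟨$⟩ (px , py) (qx , qy) (rx , ry) = solve 6 (λ px py qx qy rx ry →
    let p = px , py ; q = qx , qy ; r = rx , ry in
    (py :- qy) :* rx :+ (qx :- px) :* ry :+ ((qy :- py) :* px :- (qx :- px) :* py) := :orient p q r)
    px py qx qy rx ry

  abscissa ordinate : Affine
  abscissa = affine 1# 0# 0#
  ordinate = affine 0# 1# 0#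

  abscissa-⟨$⟩ : ∀ p → abscissa ⟨$⟩ p ≈ proj₁ p
  abscissa-⟨$⟩ (x , y) = trans (+-identityʳ _) (trans (+-cong (*-identityˡ x) (zeroˡ y)) (+-identityʳ x))

  ordinate-⟨$⟩ : ∀ p → ordinate ⟨$⟩ p ≈ proj₂ p
  ordinate-⟨$⟩ (x , y) = trans (+-identityʳ _) (trans (+-cong (zeroˡ x) (*-identityˡ y)) (+-identityˡ y))

  -- q divides the segment pr in the ratio t : s.
  record Comb (q p r : Point) : Set (c ⊔ ℓ₁ ⊔ ℓ₂) where
    constructor comb
    field
      s t     : Carrier
      s≥0     : NonNeg s
      t≥0     : NonNeg t
      s+t>0   : Pos (s + t)
      x-comb  : (s + t) * proj₁ q ≈ s * proj₁ p + t * proj₁ r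
      y-comb  : (s + t) * proj₂ q ≈ s * proj₂ p + t * proj₂ r

  comb-swap : ∀ {q p r} → Comb q p r → Comb q r p
  comb-swap (comb s t s≥0 t≥0 s+t>0 ex ey) = comb t s t≥0 s≥0 (pos-resp (+-comm s t) s+t>0)
    (trans (*-congʳ (+-comm t s)) (trans ex (+-comm _ _)))
    (trans (*-congʳ (+-comm t s)) (trans ey (+-comm _ _)))

  ⟨$⟩-comb : ∀ h {q p r} (k : Comb q p r) → let open Comb k in
    (s + t) * (h ⟨$⟩ q) ≈ s * (h ⟨$⟩ p) + t * (h ⟨$⟩ r)
  ⟨$⟩-comb (affine a b c) {qx , qy} {px , py} {rx , ry} (comb s t _ _ _ ex ey) = begin
    (s + t) * (a * qx + b * qy + c)
      ≈⟨ solve 7 (λ a b c d qx qy t → (d :+ t) :* (a :* qx :+ b :* qy :+ c) :=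
           a :* ((d :+ t) :* qx) :+ b :* ((d :+ t) :* qy) :+ (d :+ t) :* c) a b c s qx qy t ⟩
    a * ((s + t) * qx) + b * ((s + t) * qy) + (s + t) * c
      ≈⟨ +-congʳ (+-cong (*-congˡ ex) (*-congˡ ey)) ⟩
    a * (s * px + t * rx) + b * (s * py + t * ry) + (s + t) * c
      ≈⟨ solve 9 (λ a b c s t px py rx ry →
           a :* (s :* px :+ t :* rx) :+ b :* (s :* py :+ t :* ry) :+ (s :+ t) :* c :=
           s :* (a :* px :+ b :* py :+ c) :+ t :* (a :* rx :+ b :* ry :+ c)) a b c s t px py rx ry ⟩
    s * (a * px + b * py + c) + t * (a * rx + b * ry + c) ∎

  comb-end : ∀ {q p r} (k : Comb q p r) → Comb.t k ≈ 0# → q ≈p p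
  comb-end {qx , qy} {px , py} {rx , ry} (comb s t _ _ s+t>0 ex ey) t≈0 = eq ex , eq ey
    where
    eq : ∀ {q p r} → (s + t) * q ≈ s * p + t * r → q ≈ p
    eq {q} {p} {r} e = x-y≈0⇒x≈y (zero-cancel s+t>0 (begin
      (s + t) * (q - p)
        ≈⟨ solve 4 (λ s t q p → (s :+ t) :* (q :- p) := (s :+ t) :* q :- (s :+ t) :* p) s t q p ⟩
      (s + t) * q - (s + t) * p
        ≈⟨ +-congʳ e ⟩
      (s * p + t * r) - (s + t) * p
        ≈⟨ solve 4 (λ s t p r → (s :* p :+ t :* r) :- (s :+ t) :* p := t :* (r :- p)) s t p r ⟩
      t * (r - p)
        ≈⟨ zero-*ˡ _ t≈0 ⟩
      0# ∎))

  module Segment {p r : Point} (p≉r : ¬ p ≈p r) (q : Point) (coll : orient p r q ≈ 0#) where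
    private
      px = proj₁ p ; py = proj₂ p ; qx = proj₁ q ; qy = proj₂ q ; rx = proj₁ r ; ry = proj₂ r

    -- The projections of `qr` and `pq` on `pr`, scaled by the length of `pr`. Their sum is `|pr|²`,
    -- and for `q` on the line their product is `|pr|²` times `betw p q r`; with a positive sum, a
    -- nonnegative product makes both nonnegative.
    σ τ : Carrier
    σ = dot (vec q r) (vec p r)
    τ = dot (vec p q) (vec p r)

    σ+τ : Pos (σ + τ)
    σ+τ = pos-resp (solve 6 (λ px py qx qy rx ry → let p = px , py ; q = qx , qy ; r = rx , ry in
      :dot (:vec p r) (:vec p r) := :dot (:vec q r) (:vec p r) :+ :dot (:vec p q) (:vec p r))
      px py qx qy rx ry) (dist²-pos p≉r)

    σ*τ : σ * τ ≈ dist² p r * betw p q r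
    σ*τ = trans (solve 6 (λ px py qx qy rx ry → let p = px , py ; q = qx , qy ; r = rx , ry in
      :dot (:vec q r) (:vec p r) :* :dot (:vec p q) (:vec p r) :=
      :orient p r q :* :orient p r q :+ :dot (:vec p r) (:vec p r) :* :betw p q r)
      px py qx qy rx ry) (trans (+-congʳ (zero-*ˡ _ coll)) (+-identityˡ _))

    x-eq : (σ + τ) * qx ≈ σ * px + τ * rx
    x-eq = trans (solve 6 (λ px py qx qy rx ry → let p = px , py ; q = qx , qy ; r = rx , ry in
      (:dot (:vec q r) (:vec p r) :+ :dot (:vec p q) (:vec p r)) :* qx :=
      :orient p r q :* (py :- ry) :+ (:dot (:vec q r) (:vec p r) :* px :+ :dot (:vec p q) (:vec p r) :* rx))
      px py qx qy rx ry) (trans (+-congʳ (zero-*ˡ _ coll)) (+-identityˡ _))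

    y-eq : (σ + τ) * qy ≈ σ * py + τ * ry
    y-eq = trans (solve 6 (λ px py qx qy rx ry → let p = px , py ; q = qx , qy ; r = rx , ry in
      (:dot (:vec q r) (:vec p r) :+ :dot (:vec p q) (:vec p r)) :* qy :=
      :orient p r q :* (rx :- px) :+ (:dot (:vec q r) (:vec p r) :* py :+ :dot (:vec p q) (:vec p r) :* ry))
      px py qx qy rx ry) (trans (+-congʳ (zero-*ˡ _ coll)) (+-identityˡ _))

    σ≥0 : NonNeg (betw p q r) → NonNeg σ
    σ≥0 b = nonNeg-factorˡ σ+τ (nonNeg-resp (sym σ*τ) (nonNeg-* (inj₁ (dist²-pos p≉r)) b))

    τ≥0 : NonNeg (betw p q r) → NonNeg τ
    τ≥0 b = nonNeg-factorˡ (pos-resp (+-comm _ _) σ+τ)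
      (nonNeg-resp (trans (sym σ*τ) (*-comm _ _)) (nonNeg-* (inj₁ (dist²-pos p≉r)) b))

    combination : NonNeg (betw p q r) → Comb q p r
    combination b = comb σ τ (σ≥0 b) (τ≥0 b) σ+τ x-eq y-eq

    endpoint : betw p q r ≈ 0# → q ≈p p ⊎ q ≈p r
    endpoint b = case (τ≥0 (inj₂ b))
      where
      σ≈0 : Pos τ → σ ≈ 0#
      σ≈0 τ>0 = zero-cancel τ>0 (trans (*-comm _ _) (trans σ*τ (zero-*ʳ _ b)))
      case : NonNeg τ → q ≈p p ⊎ q ≈p r
      case (inj₁ τ>0) = inj₂ (comb-end (comb-swap (combination (inj₂ b))) (σ≈0 τ>0))
      case (inj₂ τ≈0) = inj₁ (comb-end (combination (inj₂ b)) τ≈0)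

  closedSeg⇒comb : ∀ {q p r} → ¬ p ≈p r → InClosedSeg q p r → Comb q p r
  closedSeg⇒comb {q} p≉r (z , inj₁ b) = Segment.combination p≉r q z (inj₁ b)
  closedSeg⇒comb {q} p≉r (z , inj₂ b) = Segment.combination p≉r q z (inj₂ (sym b))

  openSeg⇒closedSeg : ∀ {q p r} → InOpenSeg q p r → InClosedSeg q p r
  openSeg⇒closedSeg (z , b) = z , inj₁ b

  closedSeg-end : ∀ {q p r} → ¬ p ≈p r → InClosedSeg q p r → ¬ InOpenSeg q p r → q ≈p p ⊎ q ≈p r
  closedSeg-end p≉r (z , inj₁ b) no-open = ⊥-elim (no-open (z , b))
  closedSeg-end {q} p≉r (z , inj₂ b) _ = Segment.endpoint p≉r q z (sym b)

  -- The cosine rule: `|pr|² - |qr|² = |pq|² + 2 betw p q r`.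
  openSeg-dist² : ∀ {q p r} → ¬ p ≈p r → InOpenSeg q p r → Pos (dist² p r - dist² q r)
  openSeg-dist² {q@(qx , qy)} {p@(px , py)} {r@(rx , ry)} p≉r (z , b) =
    pos-resp (solve 6 (λ px py qx qy rx ry → let p = px , py ; q = qx , qy ; r = rx , ry in
      :dot (:vec p q) (:vec p q) :+ (:betw p q r :+ :betw p q r) :=
      :dot (:vec p r) (:vec p r) :- :dot (:vec q r) (:vec q r)) px py qx qy rx ry)
      (pos-resp (+-comm _ _) (pos-+-nonNeg (pos-+ b b) (nonNeg-+ (square-nonNeg _) (square-nonNeg _))))

  orient-reverse : ∀ p r q → orient r p q ≈ - orient p r q
  orient-reverse p r q = trans (sym (orient-cycle r p q)) (orient-swap₂₃ p r q)

  dist²-sym : ∀ p q → dist² p q ≈ dist² q p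
  dist²-sym (px , py) (qx , qy) = solve 4 (λ px py qx qy → let p = px , py ; q = qx , qy in
    :dot (:vec p q) (:vec p q) := :dot (:vec q p) (:vec q p)) px py qx qy

  betw-sym : ∀ p q r → betw p q r ≈ betw r q p
  betw-sym (px , py) (qx , qy) (rx , ry) = solve 6 (λ px py qx qy rx ry → let p = px , py ; q = qx , qy ; r = rx , ry in
    :betw p q r := :betw r q p) px py qx qy rx ry

  openSeg-sym : ∀ {q p r} → InOpenSeg q p r → InOpenSeg q r p
  openSeg-sym {q} {p} {r} (z , b) = trans (orient-reverse p r q) (-zero z) , pos-resp (betw-sym p q r) b

  comb-pos : ∀ h {q p r} → Comb q p r → Pos (h ⟨$⟩ p) → Pos (h ⟨$⟩ r) → Pos (h ⟨$⟩ q)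
  comb-pos h k@(comb s t (inj₁ s>0) t≥0 s+t>0 _ _) hp hr =
    pos-cancel s+t>0 (pos-resp (sym (⟨$⟩-comb h k)) (pos-+-nonNeg (*-pos s>0 hp) (nonNeg-* t≥0 (inj₁ hr))))
  comb-pos h {q} {p} {r} k@(comb s t (inj₂ s≈0) t≥0 s+t>0 _ _) hp hr =
    pos-resp (⟨$⟩-cong h (≈p-sym (comb-end (comb-swap k) s≈0))) hr

  comb-nonNeg : ∀ h {q p r} → Comb q p r → NonNeg (h ⟨$⟩ p) → NonNeg (h ⟨$⟩ r) → NonNeg (h ⟨$⟩ q)
  comb-nonNeg h k@(comb s t s≥0 t≥0 s+t>0 _ _) hp hr =
    nonNeg-cancel s+t>0 (nonNeg-resp (sym (⟨$⟩-comb h k)) (nonNeg-+ (nonNeg-* s≥0 hp) (nonNeg-* t≥0 hr)))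

  -- Evaluating `h` leaves `t * h(r) = 0`, hence `t = 0`. This is how an intersection point is
  -- recognised as an endpoint.
  comb-vertex : ∀ h {q p r} → Comb q p r → h ⟨$⟩ q ≈ 0# → h ⟨$⟩ p ≈ 0# → ¬ h ⟨$⟩ r ≈ 0# → q ≈p p
  comb-vertex h {q} {p} {r} k@(comb s t s≥0 t≥0 s+t>0 _ _) hq hp hr = comb-end k t≈0
    where
    t*hr : t * (h ⟨$⟩ r) ≈ 0#
    t*hr = begin
      t * (h ⟨$⟩ r)                     ≈⟨ +-identityˡ _ ⟨
      0# + t * (h ⟨$⟩ r)                ≈⟨ +-congʳ (zero-*ʳ s hp) ⟨
      s * (h ⟨$⟩ p) + t * (h ⟨$⟩ r)     ≈⟨ ⟨$⟩-comb h k ⟨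
      (s + t) * (h ⟨$⟩ q)               ≈⟨ zero-*ʳ _ hq ⟩
      0#                                ∎
    t≈0 : t ≈ 0#
    t≈0 with sign (h ⟨$⟩ r)
    ... | pos p = zero-cancel p (trans (*-comm _ _) t*hr)
    ... | zer z = ⊥-elim (hr z)
    ... | neg n = zero-cancel n (trans (*-comm _ _) (trans (sym (*-neg t _)) (-zero t*hr)))

  comb-zero : ∀ h {q p r} → Comb q p r → h ⟨$⟩ p ≈ 0# → h ⟨$⟩ r ≈ 0# → h ⟨$⟩ q ≈ 0#
  comb-zero h k@(comb s t s≥0 t≥0 s+t>0 _ _) hp hr =
    zero-cancel s+t>0 (trans (⟨$⟩-comb h k) (zero-+ (zero-*ʳ s hp) (zero-*ʳ t hr)))

  -- A functional whose sign is that of f, with the zeros of f decided by g: K f + g for large K.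
  module Refinement {a} {X : Set a} (pt : X → Point) (f g : Affine) where

    record Refines (h : Affine) (x : X) : Set (ℓ₁ ⊔ ℓ₂) where
      field
        on-pos  : Pos (f ⟨$⟩ pt x) → Pos (h ⟨$⟩ pt x)
        on-neg  : Pos (- (f ⟨$⟩ pt x)) → Pos (- (h ⟨$⟩ pt x))
        on-zero : f ⟨$⟩ pt x ≈ 0# → h ⟨$⟩ pt x ≈ g ⟨$⟩ pt x
    open Refines public

    private
      h : Carrier → Affine
      h k = scale k f ∔ g

      h-⟨$⟩ : ∀ k p → h k ⟨$⟩ p ≈ k * (f ⟨$⟩ p) + g ⟨$⟩ p
      h-⟨$⟩ k p = trans (∔-⟨$⟩ (scale k f) g p) (+-congʳ (scale-⟨$⟩ k f p))

      -- Asking for all larger factors as well lets the greatest threshold serve a whole list.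
      LargeFor : Carrier → X → Set _
      LargeFor k x = ∀ k' → NonNeg (k' - k) → Refines (h k') x

      -- The threshold is (1 - g)/f where f > 0, and (-1 - g)/f where f < 0.
      large : ∀ x → ∃ λ k → LargeFor k x
      large x with sign (f ⟨$⟩ pt x)
      ... | zer z = 0# , λ k' _ → record
        { on-pos = λ p → ⊥-elim (pos⇒≉0 p z)
        ; on-neg = λ n → ⊥-elim (pos⇒≉0 n (-zero z))
        ; on-zero = λ _ → trans (h-⟨$⟩ k' (pt x)) (trans (+-congʳ (zero-*ʳ k' z)) (+-identityˡ _)) }
      ... | pos p = k , λ k' k'≥k → record
        { on-pos = λ _ → pos-resp (trans (margin k') (sym (h-⟨$⟩ k' (pt x)))) (pos-+-nonNeg pos-1 (nonNeg-* k'≥k (inj₁ p)))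
        ; on-neg = λ n → ⊥-elim (pos-neg p n)
        ; on-zero = λ z → ⊥-elim (pos⇒≉0 p z) }
        where
        fx = f ⟨$⟩ pt x
        gx = g ⟨$⟩ pt x
        i = proj₁ (inverse fx (pos⇒≉0 p))
        k = i * (1# - gx)
        margin : ∀ k' → 1# + (k' - k) * fx ≈ k' * fx + gx
        margin k' = begin
          1# + (k' - i * (1# - gx)) * fx
            ≈⟨ solve 5 (λ o k' i g f → o :+ (k' :- i :* (o :- g)) :* f :=
                 o :+ k' :* f :- (f :* i) :* (o :- g)) 1# k' i gx fx ⟩
          1# + k' * fx - (fx * i) * (1# - gx)
            ≈⟨ +-congˡ (-‿cong (trans (*-congʳ (proj₂ (inverse fx (pos⇒≉0 p)))) (*-identityˡ _))) ⟩
          1# + k' * fx - (1# - gx)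
            ≈⟨ solve 3 (λ o a g → o :+ a :- (o :- g) := a :+ g) 1# (k' * fx) gx ⟩
          k' * fx + gx ∎
      ... | neg n = k , λ k' k'≥k → record
        { on-pos = λ p → ⊥-elim (pos-neg p n)
        ; on-neg = λ _ → pos-resp (trans (margin k') (-‿cong (sym (h-⟨$⟩ k' (pt x))))) (pos-+-nonNeg pos-1 (nonNeg-* k'≥k (inj₁ n)))
        ; on-zero = λ z → ⊥-elim (pos⇒≉0 n (-zero z)) }
        where
        fx = f ⟨$⟩ pt x
        gx = g ⟨$⟩ pt x
        fx≉0 : ¬ fx ≈ 0#
        fx≉0 z = pos⇒≉0 n (-zero z)
        i = proj₁ (inverse fx fx≉0)
        k = i * (- 1# - gx)
        margin : ∀ k' → 1# + (k' - k) * (- fx) ≈ - (k' * fx + gx)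
        margin k' = begin
          1# + (k' - i * (- 1# - gx)) * (- fx)
            ≈⟨ solve 5 (λ o k' i g f → o :+ (k' :- i :* (:- o :- g)) :* (:- f) :=
                 o :- k' :* f :+ (f :* i) :* (:- o :- g)) 1# k' i gx fx ⟩
          1# - k' * fx + (fx * i) * (- 1# - gx)
            ≈⟨ +-congˡ (trans (*-congʳ (proj₂ (inverse fx fx≉0))) (*-identityˡ _)) ⟩
          1# - k' * fx + (- 1# - gx)
            ≈⟨ solve 3 (λ o a g → o :- a :+ (:- o :- g) := :- (a :+ g)) 1# (k' * fx) gx ⟩
          - (k' * fx + gx) ∎

      large-all : ∀ xs → ∃ λ k → ∀ {x} → x ∈ xs → LargeFor k x
      large-all [] = 0# , λ ()
      large-all (x ∷ xs) with large x | large-all xs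
      ... | k₁ , l₁ | k₂ , l₂ with nonNeg-total k₁ k₂
      ...   | inj₁ k₁≥k₂ = k₁ , λ { (here ≡.refl) → l₁
                                  ; (there x∈) k' k'≥ → l₂ x∈ k' (nonNeg-trans k'≥ k₁≥k₂) }
      ...   | inj₂ k₂≥k₁ = k₂ , λ { (here ≡.refl) k' k'≥ → l₁ k' (nonNeg-trans k'≥ k₂≥k₁)
                                  ; (there x∈) → l₂ x∈ }

    refine : ∀ xs → ∃ λ h → ∀ {x} → x ∈ xs → Refines h x
    refine xs with large-all xs
    ... | k , l = h k , λ x∈ → l x∈ k (inj₂ (-‿inverseʳ k))

  -- Angular order

  cross[_] : Bool → Point → Point → Carrier
  cross[ true ] v w = cross v w
  cross[ false ] v w = cross w v

  cross-antisym : ∀ b v w → cross[ b ] w v ≈ - cross[ b ] v w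
  cross-antisym true (vx , vy) (wx , wy) = solve 4 (λ vx vy wx wy →
    :cross (wx , wy) (vx , vy) := :- :cross (vx , vy) (wx , wy)) vx vy wx wy
  cross-antisym false (vx , vy) (wx , wy) = solve 4 (λ vx vy wx wy →
    :cross (vx , vy) (wx , wy) := :- :cross (wx , wy) (vx , vy)) vx vy wx wy

  -- The linear relation `(v × w) u - (u × w) v + (u × v) w = 0` of three plane vectors, with
  -- `linear h` applied to it.
  cross-linear : ∀ b h u v w →
    linear h v * cross[ b ] u w ≈ linear h u * cross[ b ] v w + linear h w * cross[ b ] u v
  cross-linear true h (ux , uy) (vx , vy) (wx , wy) = solve 8
    (λ a b ux uy vx vy wx wy → let u = ux , uy ; v = vx , vy ; w = wx , wy ; l = a , b in
    :dot l v :* :cross u w := :dot l u :* :cross v w :+ :dot l w :* :cross u v) (α h) (β h) ux uy vx vy wx wy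
  cross-linear false h (ux , uy) (vx , vy) (wx , wy) = solve 8
    (λ a b ux uy vx vy wx wy → let u = ux , uy ; v = vx , vy ; w = wx , wy ; l = a , b in
    :dot l v :* :cross w u := :dot l u :* :cross w v :+ :dot l w :* :cross v u) (α h) (β h) ux uy vx vy wx wy

  -- Vectors in an open half-plane, ordered counterclockwise (true) or clockwise (false),
  -- with ties broken by μ.
  module Angular (b : Bool) (μ : Point → Carrier) where

    private
      X = cross[ b ]
      X-antisym = cross-antisym b
      X-linear = cross-linear b

    infix 4 _⊑_
    _⊑_ : Point → Point → Set (ℓ₁ ⊔ ℓ₂)
    v ⊑ w = Pos (X v w) ⊎ (X v w ≈ 0# × NonNeg (μ w - μ v))

    ⊑-total : ∀ v w → v ⊑ w ⊎ w ⊑ v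
    ⊑-total v w with sign (X v w)
    ... | pos p = inj₁ (inj₁ p)
    ... | neg n = inj₂ (inj₁ (pos-resp (sym (X-antisym v w)) n))
    ... | zer z with nonNeg-total (μ w) (μ v)
    ...   | inj₁ n = inj₁ (inj₂ (z , n))
    ...   | inj₂ n = inj₂ (inj₂ (trans (X-antisym v w) (-zero z) , n))

    ⊑⇒X≥0 : ∀ {v w} → v ⊑ w → NonNeg (X v w)
    ⊑⇒X≥0 (inj₁ p) = inj₁ p
    ⊑⇒X≥0 (inj₂ (z , _)) = inj₂ z

    -- `cross-linear` makes `X u w` a combination of `X u v` and `X v w` whose coefficients are
    -- positive in the half-plane of `h`. Over the full circle transitivity would fail.
    ⊑-trans : ∀ h {u v w} → Pos (linear h u) → Pos (linear h v) → Pos (linear h w) →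
              u ⊑ v → v ⊑ w → u ⊑ w
    ⊑-trans h {u} {v} {w} pu pv pw (inj₁ uv) vw = inj₁ (pos-cancel pv (pos-resp (trans (+-comm _ _) (sym (X-linear h u v w)))
      (pos-+-nonNeg (*-pos pw uv) (nonNeg-* (inj₁ pu) (⊑⇒X≥0 vw)))))
    ⊑-trans h {u} {v} {w} pu pv pw (inj₂ (z , m)) (inj₁ vw) = inj₁ (pos-cancel pv (pos-resp (sym (X-linear h u v w))
      (pos-+-nonNeg (*-pos pu vw) (nonNeg-* (inj₁ pw) (inj₂ z)))))
    ⊑-trans h {u} {v} {w} pu pv pw (inj₂ (z , m)) (inj₂ (z' , m')) = inj₂
      (zero-cancel pv (trans (X-linear h u v w) (zero-+ (zero-*ʳ _ z') (zero-*ʳ _ z))) , nonNeg-trans m' m)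

  offset : Affine → Carrier → Affine
  offset h a = h ∔ constant (- a)

  offset-⟨$⟩ : ∀ h a p → offset h a ⟨$⟩ p ≈ h ⟨$⟩ p - a
  offset-⟨$⟩ h a p = trans (∔-⟨$⟩ h (constant (- a)) p) (+-congˡ (constant-⟨$⟩ (- a) p))

  falling : Affine → Carrier → Affine
  falling h a = negate (offset h a)

  falling-⟨$⟩ : ∀ h a p → falling h a ⟨$⟩ p ≈ a - h ⟨$⟩ p
  falling-⟨$⟩ h a p = trans (negate-⟨$⟩ (offset h a) p)
    (trans (-‿cong (offset-⟨$⟩ h a p)) (neg-swap (h ⟨$⟩ p) a))

  -- `h` increases from `p` to `t` and so is a coordinate on their line.
  level-injective : ∀ h {p t u v} → Pos (linear h (vec p t)) →
    orient p t u ≈ 0# → orient p t v ≈ 0# → h ⟨$⟩ u ≈ h ⟨$⟩ v → u ≈p v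
  level-injective (affine a b c) {p@(px , py)} {t@(tx , ty)} {u@(ux , uy)} {v@(vx , vy)} pt zu zv huv =
    x-y≈0⇒x≈y (zero-cancel pt (trans
      (solve 11 (λ a b c px py tx ty ux uy vx vy → let p = px , py ; t = tx , ty ; u = ux , uy ; v = vx , vy in
        :dot (a , b) (:vec p t) :* (ux :- vx) :=
        ((a :* ux :+ b :* uy :+ c) :- (a :* vx :+ b :* vy :+ c)) :* (tx :- px) :+ (:- b) :* (:orient p t u :- :orient p t v))
        a b c px py tx ty ux uy vx vy)
      (zero-+ (zero-*ˡ _ (x≈y⇒x-y≈0 huv)) (zero-*ʳ _ (x≈y⇒x-y≈0 (trans zu (sym zv)))))))
    , x-y≈0⇒x≈y (zero-cancel pt (trans
      (solve 11 (λ a b c px py tx ty ux uy vx vy → let p = px , py ; t = tx , ty ; u = ux , uy ; v = vx , vy in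
        :dot (a , b) (:vec p t) :* (uy :- vy) :=
        ((a :* ux :+ b :* uy :+ c) :- (a :* vx :+ b :* vy :+ c)) :* (ty :- py) :+ a :* (:orient p t u :- :orient p t v))
        a b c px py tx ty ux uy vx vy)
      (zero-+ (zero-*ˡ _ (x≈y⇒x-y≈0 huv)) (zero-*ʳ _ (x≈y⇒x-y≈0 (trans zu (sym zv)))))))

  -- Mirror images are treated together: `b` fixes the sense of rotation, and the sign makes the
  -- same inequalities describe both inner tangents.
  signed : Bool → Carrier → Carrier
  signed true x = - x
  signed false x = x

  signed-zero : ∀ b {x} → x ≈ 0# → signed b x ≈ 0#
  signed-zero true z = -zero z
  signed-zero false z = z

  signed-zero⁻ : ∀ b {x} → signed b x ≈ 0# → x ≈ 0#
  signed-zero⁻ true z = trans (solve 1 (λ x → x := :- (:- x)) _) (-zero z)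
  signed-zero⁻ false z = z

  signedThrough : Bool → Point → Point → Affine
  signedThrough true p q = negate (through p q)
  signedThrough false p q = through p q

  signedThrough-⟨$⟩ : ∀ b p q r → signedThrough b p q ⟨$⟩ r ≈ signed b (orient p q r)
  signedThrough-⟨$⟩ true p q r = trans (negate-⟨$⟩ (through p q) r) (-‿cong (through-⟨$⟩ p q r))
  signedThrough-⟨$⟩ false p q r = through-⟨$⟩ p q r

  cross-from : ∀ b p q r → cross[ b ] (vec p q) (vec p r) ≈ - signed b (orient p q r)
  cross-from true p q r = solve 1 (λ x → x := :- (:- x)) _
  cross-from false p q r = cross-antisym true (vec p q) (vec p r)

  cross-to : ∀ b p q r → cross[ b ] (vec p q) (vec r q) ≈ signed b (orient p q r)
  cross-to true (px , py) (qx , qy) (rx , ry) = solve 6 (λ px py qx qy rx ry → let p = px , py ; q = qx , qy ; r = rx , ry in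
    :cross (:vec p q) (:vec r q) := :- :orient p q r) px py qx qy rx ry
  cross-to false (px , py) (qx , qy) (rx , ry) = solve 6 (λ px py qx qy rx ry → let p = px , py ; q = qx , qy ; r = rx , ry in
    :cross (:vec r q) (:vec p q) := :orient p q r) px py qx qy rx ry

  -- Vectors on one line are parallel, so the two orientation functionals stand in the ratio of the
  -- vectors, measured by `h`. Where `h` rises along both, the functionals therefore have the same
  -- sign.
  same-line : ∀ h p q p' q' v → orient p q p' ≈ 0# → orient p q q' ≈ 0# →
    linear h (vec p q) * orient p' q' v ≈ linear h (vec p' q') * orient p q v
  same-line (affine a b c) p@(px , py) q@(qx , qy) p'@(p'x , p'y) q'@(q'x , q'y) v@(vx , vy) zp zq = begin
    linear h (vec p q) * orient p' q' v
      ≈⟨ solve 12 (λ a b px py qx qy p'x p'y q'x q'y vx vy →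
           let p = px , py ; q = qx , qy ; p' = p'x , p'y ; q' = q'x , q'y ; v = vx , vy ; l = a , b in
           :dot l (:vec p q) :* :orient p' q' v :=
           :dot l (:vec p' q') :* :orient p q v :+
           ((:- :dot l (:vec p' q')) :* :orient p q p' :+
            :dot l (:vec p' v) :* (:orient p q p' :- :orient p q q')))
           a b px py qx qy p'x p'y q'x q'y vx vy ⟩
    linear h (vec p' q') * orient p q v +
      (- linear h (vec p' q') * orient p q p' + linear h (vec p' v) * (orient p q p' - orient p q q'))
      ≈⟨ +-congˡ (zero-+ (zero-*ʳ _ zp) (zero-*ʳ _ (x≈y⇒x-y≈0 (trans zp (sym zq))))) ⟩
    linear h (vec p' q') * orient p q v + 0#
      ≈⟨ +-identityʳ _ ⟩
    linear h (vec p' q') * orient p q v ∎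
    where h = affine a b c

-- Finite lists and colour counts

module _ {a} {A : Set a} where

  extract : ∀ {x : A} {xs} → x ∈ xs → ∃ λ ys → xs ↭ x ∷ ys
  extract x∈xs with ∈-∃++ x∈xs
  ... | ys , zs , ≡.refl = ys ++ zs , shift _ ys zs

  separate-↭ : ∀ {p} {P : A → Set p} → Decidable P → ∀ xs →
    ∃ λ ys → ∃ λ zs → xs ↭ ys ++ zs × All P ys × All (λ x → ¬ P x) zs
  separate-↭ P? [] = [] , [] , ↭-refl , [] , []
  separate-↭ P? (x ∷ xs) with P? x | separate-↭ P? xs
  ... | yes px | ys , zs , e , pys , pzs = x ∷ ys , zs , prep x e , px ∷ pys , pzs
  ... | no ¬px | ys , zs , e , pys , pzs =
    ys , x ∷ zs , ↭-trans (prep x e) (↭-sym (shift x ys zs)) , pys , ¬px ∷ pzs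

indicator : Bool → Bool → ℕ
indicator true  true  = 1
indicator true  false = 0
indicator false true  = 0
indicator false false = 1

indicator-same : ∀ c → indicator c c ≡ 1
indicator-same true = ≡.refl
indicator-same false = ≡.refl

indicator-other : ∀ c → indicator (not c) c ≡ 0
indicator-other true = ≡.refl
indicator-other false = ≡.refl

indicator≤1 : ∀ c d → indicator c d ℕ.≤ 1
indicator≤1 true true = s≤s z≤n
indicator≤1 true false = z≤n
indicator≤1 false true = z≤n
indicator≤1 false false = s≤s z≤n

module Counting {a} {A : Set a} (colour : A → Bool) where

  count : Bool → List A → ℕ
  count c [] = 0
  count c (x ∷ xs) = indicator c (colour x) ℕ.+ count c xs

  count-++ : ∀ c xs ys → count c (xs ++ ys) ≡ count c xs ℕ.+ count c ys
  count-++ c [] ys = ≡.refl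
  count-++ c (x ∷ xs) ys = ≡.trans (≡.cong (indicator c (colour x) ℕ.+_) (count-++ c xs ys))
    (≡.sym (ℕₚ.+-assoc (indicator c (colour x)) _ _))

  count-↭ : ∀ c {xs ys} → xs ↭ ys → count c xs ≡ count c ys
  count-↭ c _↭_.refl = ≡.refl
  count-↭ c (prep x e) = ≡.cong (indicator c (colour x) ℕ.+_) (count-↭ c e)
  count-↭ c {x ∷ y ∷ xs} {_ ∷ _ ∷ ys} (swap x y e) = ≡.trans (≡.cong (λ k → i ℕ.+ (j ℕ.+ k)) (count-↭ c e))
    (≡.trans (≡.sym (ℕₚ.+-assoc i j _)) (≡.trans (≡.cong (ℕ._+ count c ys) (ℕₚ.+-comm i j)) (ℕₚ.+-assoc j i _)))
    where
    i = indicator c (colour x)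
    j = indicator c (colour y)
  count-↭ c (_↭_.trans e f) = ≡.trans (count-↭ c e) (count-↭ c f)

  count-member : ∀ c xs → 1 ℕ.≤ count c xs → ∃ λ x → x ∈ xs × colour x ≡ c
  count-member c (x ∷ xs) le with colour x in eq
  count-member true  (x ∷ xs) le | true = x , here ≡.refl , eq
  count-member false (x ∷ xs) le | false = x , here ≡.refl , eq
  count-member true  (x ∷ xs) le | false = let y , y∈ , e = count-member true xs le in y , there y∈ , e
  count-member false (x ∷ xs) le | true = let y , y∈ , e = count-member false xs le in y , there y∈ , e

  count-sum : ∀ c xs → count c xs ℕ.+ count (not c) xs ≡ length xs
  count-sum c [] = ≡.refl
  count-sum c (x ∷ xs) = ≡.trans (lemma (indicator c (colour x)) (indicator (not c) (colour x)) (count c xs) _)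
    (≡.cong₂ ℕ._+_ (one c (colour x)) (count-sum c xs))
    where
    one : ∀ c d → indicator c d ℕ.+ indicator (not c) d ≡ 1
    one true true = ≡.refl
    one true false = ≡.refl
    one false true = ≡.refl
    one false false = ≡.refl
    lemma : ∀ i j m n → (i ℕ.+ m) ℕ.+ (j ℕ.+ n) ≡ (i ℕ.+ j) ℕ.+ (m ℕ.+ n)
    lemma i j m n = ≡.trans (ℕₚ.+-assoc i m _) (≡.trans (≡.cong (i ℕ.+_)
      (≡.trans (≡.sym (ℕₚ.+-assoc m j n)) (≡.trans (≡.cong (ℕ._+ n) (ℕₚ.+-comm m j)) (ℕₚ.+-assoc j m n))))
      (≡.sym (ℕₚ.+-assoc i j _)))

-- The laws are required only on `Q` to cover the angular order, which is transitive only inside an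
-- open half-plane.
module TotalPreorder {a q r} {A : Set a} (Q : A → Set q) (_≼_ : A → A → Set r)
  (total : ∀ {x y} → Q x → Q y → x ≼ y ⊎ y ≼ x)
  (≼-trans : ∀ {x y z} → Q x → Q y → Q z → x ≼ y → y ≼ z → x ≼ z) where

  ≼-refl : ∀ {x} → Q x → x ≼ x
  ≼-refl q with total q q
  ... | inj₁ l = l
  ... | inj₂ l = l

  extractMin : ∀ x xs → All Q (x ∷ xs) → ∃ λ m → ∃ λ rest → x ∷ xs ↭ m ∷ rest × All (m ≼_) rest
  extractMin x [] _ = x , [] , ↭-refl , []
  extractMin x (y ∷ ys) (qx ∷ qs) with extractMin y ys qs
  ... | m , rest , e , m≼ with All-resp-↭ e qs
  ...   | qm ∷ qrest with total qx qm
  ...     | inj₁ x≼m = x , y ∷ ys , ↭-refl ,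
              All-resp-↭ (↭-sym e) (x≼m ∷ All.zipWith (λ (qz , m≼z) → ≼-trans qx qm qz x≼m m≼z) (qrest , m≼))
  ...     | inj₂ m≼x = m , x ∷ rest , ↭-trans (prep x e) (swap x m ↭-refl) , m≼x ∷ m≼

  minimum : ∀ {x xs} → x ∈ xs → All Q xs → ∃ λ m → m ∈ xs × (∀ {y} → y ∈ xs → m ≼ y)
  minimum {xs = y ∷ ys} _ qs with extractMin y ys qs
  ... | m , rest , e , m≼ = m , ∈-resp-↭ (↭-sym e) (here ≡.refl) , λ y∈ → least (∈-resp-↭ e y∈)
    where
    least : ∀ {y} → y ∈ m ∷ rest → m ≼ y
    least (here ≡.refl) = ≼-refl (All.lookup qs (∈-resp-↭ (↭-sym e) (here ≡.refl)))
    least (there y∈) = All.lookup m≼ y∈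

  module _ (colour : A → Bool) where
    open Counting colour

    -- `last` marks the place of the cut: the line that separates prefix and suffix is later drawn
    -- through it.
    record BalancedPrefix (c : Bool) (xs : List A) : Set (a ⊔ r) where
      field
        prefix suffix : List A
        perm          : xs ↭ prefix ++ suffix
        last          : A
        last∈         : last ∈ prefix
        ≼last         : ∀ {x} → x ∈ prefix → x ≼ last
        last≼         : ∀ {x} → x ∈ suffix → last ≼ x
        balanced      : count c prefix ≡ count (not c) prefix

    -- Moving the minimum of the rest to the prefix changes the balance by one,
    -- so it cannot change sign without vanishing.
    balancedPrefix : ∀ c k ps rs → length rs ℕ.≤ k → All Q ps → All Q rs →
      (∀ {x y} → x ∈ ps → y ∈ rs → x ≼ y) →
      count (not c) ps ℕ.< count c ps →
      count c (ps ++ rs) ℕ.≤ count (not c) (ps ++ rs) →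
      BalancedPrefix c (ps ++ rs)
    balancedPrefix c k ps [] _ _ _ _ gt le =
      ⊥-elim (ℕₚ.<⇒≱ gt (≡.subst₂ ℕ._≤_ (nil c) (nil (not c)) le))
      where
      nil : ∀ d → count d (ps ++ []) ≡ count d ps
      nil d = ≡.trans (count-++ d ps []) (ℕₚ.+-identityʳ _)
    -- Extracting the minimum permutes the rest, so the recursion descends on the bound `k` for its
    -- length.
    balancedPrefix c (suc k) ps (r ∷ rs) (s≤s len) qps qrs ps≼rs gt le with extractMin r rs qrs
    ... | m , rest , e , m≼ = go (count c ps' ℕ.≤? count (not c) ps')
      where
      ps' = m ∷ ps
      qs' : All Q (m ∷ rest)
      qs' = All-resp-↭ e qrs
      perm' : ps ++ r ∷ rs ↭ ps' ++ rest
      perm' = ↭-trans (++⁺ˡ ps e) (shift m ps rest)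
      ps'≼m : ∀ {x} → x ∈ ps' → x ≼ m
      ps'≼m (here ≡.refl) = ≼-refl (All.head qs')
      ps'≼m (there x∈) = ps≼rs x∈ (∈-resp-↭ (↭-sym e) (here ≡.refl))
      ps'≼rest : ∀ {x y} → x ∈ ps' → y ∈ rest → x ≼ y
      ps'≼rest (here ≡.refl) y∈ = All.lookup m≼ y∈
      ps'≼rest (there x∈) y∈ = ps≼rs x∈ (∈-resp-↭ (↭-sym e) (there y∈))
      go : Dec (count c ps' ℕ.≤ count (not c) ps') → BalancedPrefix c (ps ++ r ∷ rs)
      go (yes le') = record
        { prefix = ps' ; suffix = rest ; perm = perm' ; last = m ; last∈ = here ≡.refl
        ; ≼last = ps'≼m ; last≼ = All.lookup m≼
        ; balanced = ℕₚ.≤-antisym le' (ℕₚ.≤-trans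
            (ℕₚ.≤-trans (ℕₚ.+-monoˡ-≤ _ (indicator≤1 (not c) (colour m))) gt)
            (ℕₚ.m≤n+m _ (indicator c (colour m)))) }
      go (no gt') = record
        { prefix = prefix ; suffix = suffix ; perm = ↭-trans perm' perm ; last = last ; last∈ = last∈
        ; ≼last = ≼last ; last≼ = last≼ ; balanced = balanced }
        where
        len' : length rest ℕ.≤ k
        len' = ℕₚ.≤-trans (ℕₚ.≤-reflexive (ℕₚ.suc-injective (≡.sym (↭-length e)))) len
        open BalancedPrefix (balancedPrefix c k ps' rest len' (All.head qs' ∷ qps) (All.tail qs') ps'≼rest
          (ℕₚ.≰⇒> gt') (≡.subst₂ ℕ._≤_ (count-↭ c perm') (count-↭ (not c) perm') le))

-- Drawings

module Drawings {c ℓ₁ ℓ₂} (F : OrderedField c ℓ₁ ℓ₂) (n : ℕ) (A B : Fin n → Geometry.Point F)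
  (A-injective : Injective _≡_ (Geometry._≈p_ F) A)
  (B-injective : Injective _≡_ (Geometry._≈p_ F) B)
  (A≉B : ∀ i j → ¬ Geometry._≈p_ F (A i) (B j)) where

  open OrderedField F hiding (zero)
  open Geometry F
  open Bivis n A B
  open Positivity F
  open Plane F
  open IntegerCoefficients commutativeRing using (solve; _:=_; _:+_; _:-_)
  open import Algebra.Properties.Ring ring using (-‿involutive)

  colour : V → Bool
  colour (inj₁ _) = true
  colour (inj₂ _) = false

  open Counting colour public

  infix 4 _≟V_
  _≟V_ : (u v : V) → Dec (u ≡ v)
  _≟V_ = Sum.≡-dec Fin._≟_ Fin._≟_

  open import Data.List.Membership.DecPropositional _≟V_ using (_∈?_)

  pt-injective : ∀ {u v} → pt u ≈p pt v → u ≡ v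
  pt-injective {inj₁ i} {inj₁ j} e = ≡.cong inj₁ (A-injective e)
  pt-injective {inj₁ i} {inj₂ j} e = ⊥-elim (A≉B i j e)
  pt-injective {inj₂ i} {inj₁ j} e = ⊥-elim (A≉B j i (≈p-sym e))
  pt-injective {inj₂ i} {inj₂ j} e = ≡.cong inj₂ (B-injective e)

  infix 9 _⟪_⟫
  _⟪_⟫ : Affine → V → Carrier
  h ⟪ v ⟫ = h ⟨$⟩ pt v

  End : V → Edge → Set
  End w (i , j) = w ≡ inj₁ i ⊎ w ≡ inj₂ j

  OnEdge : Point → Edge → Set _
  OnEdge q (i , j) = InClosedSeg q (A i) (B j)

  onEdge⇒comb : ∀ {q} e → OnEdge q e → Comb q (A (proj₁ e)) (B (proj₂ e))
  onEdge⇒comb (i , j) = closedSeg⇒comb (A≉B i j)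

  commonEnd : ∀ {w q} e f → End w e → End w f → q ≈p pt w → CommonEndpoint q e f
  commonEnd e f (inj₁ ≡.refl) (inj₁ ≡.refl) q≈w = inj₁ (≡.refl , q≈w)
  commonEnd e f (inj₂ ≡.refl) (inj₂ ≡.refl) q≈w = inj₂ (≡.refl , q≈w)

  nonCrossing-sym : ∀ {e f} → NonCrossingPair e f → NonCrossingPair f e
  nonCrossing-sym nc q qf qe with nc q qe qf
  ... | inj₁ (≡.refl , e) = inj₁ (≡.refl , e)
  ... | inj₂ (≡.refl , e) = inj₂ (≡.refl , e)

  Inside : List V → Edge → Set
  Inside vs (i , j) = inj₁ i ∈ vs × inj₂ j ∈ vs

  end∈ : ∀ {vs w} e → Inside vs e → End w e → w ∈ vs
  end∈ e (i∈ , j∈) (inj₁ ≡.refl) = i∈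
  end∈ e (i∈ , j∈) (inj₂ ≡.refl) = j∈

  infix 4 _⊆_
  _⊆_ : List V → List V → Set
  us ⊆ vs = ∀ {v} → v ∈ us → v ∈ vs

  -- `Adjacent` speaks of all vertices, so that a drawing of a part is valid in the whole as it
  -- stands; only `inside` refers to `vs`.
  record Drawing (vs : List V) (k : ℕ) : Set (c ⊔ ℓ₁ ⊔ ℓ₂) where
    field
      edges       : List Edge
      nonCrossing : NonCrossingSubgraph edges
      inside      : ∀ {e} → e ∈ edges → Inside vs e
      enough      : k ℕ.≤ length edges
  open Drawing

  weaken : ∀ {us vs k l} → us ⊆ vs → l ℕ.≤ k → Drawing us k → Drawing vs l
  weaken us⊆vs l≤k d = record
    { edges = edges d ; nonCrossing = nonCrossing d
    ; inside = λ e∈ → let i∈ , j∈ = inside d e∈ in us⊆vs i∈ , us⊆vs j∈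
    ; enough = ℕₚ.≤-trans l≤k (enough d) }

  append : ∀ {us vs ws k l} (d : Drawing us k) (d' : Drawing vs l) → us ⊆ ws → vs ⊆ ws →
    (∀ {e f} → e ∈ edges d → f ∈ edges d' → e ≢ f × NonCrossingPair e f) → Drawing ws (k ℕ.+ l)
  append d d' us⊆ws vs⊆ws cross = record
    { edges = edges d ++ edges d'
    ; nonCrossing = unique , adjacent , noncrossing
    ; inside = λ e∈ → [ (λ e∈ → let i∈ , j∈ = inside d e∈ in us⊆ws i∈ , us⊆ws j∈)
                      , (λ e∈ → let i∈ , j∈ = inside d' e∈ in vs⊆ws i∈ , vs⊆ws j∈) ]′ (∈-++⁻ (edges d) e∈)
    ; enough = ≡.subst (_ ℕ.≤_) (≡.sym (Listₚ.length-++ (edges d))) (ℕₚ.+-mono-≤ (enough d) (enough d'))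
    }
    where
    unique : Unique (edges d ++ edges d')
    unique = Uniqueₚ.++⁺ (proj₁ (nonCrossing d)) (proj₁ (nonCrossing d'))
      (λ (e∈ , e∈') → proj₁ (cross e∈ e∈') ≡.refl)
    adjacent : ∀ {e} → e ∈ edges d ++ edges d' → Adjacent e
    adjacent e∈ with ∈-++⁻ (edges d) e∈
    ... | inj₁ e∈ = proj₁ (proj₂ (nonCrossing d)) e∈
    ... | inj₂ e∈ = proj₁ (proj₂ (nonCrossing d')) e∈
    noncrossing : ∀ {e f} → e ∈ edges d ++ edges d' → f ∈ edges d ++ edges d' → e ≢ f → NonCrossingPair e f
    noncrossing {e} {f} e∈ f∈ e≢f with ∈-++⁻ (edges d) e∈ | ∈-++⁻ (edges d) f∈
    ... | inj₁ e∈ | inj₁ f∈ = proj₂ (proj₂ (nonCrossing d)) e∈ f∈ e≢f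
    ... | inj₁ e∈ | inj₂ f∈ = proj₂ (cross e∈ f∈)
    ... | inj₂ e∈ | inj₁ f∈ = nonCrossing-sym {f} {e} (proj₂ (cross f∈ e∈))
    ... | inj₂ e∈ | inj₂ f∈ = proj₂ (proj₂ (nonCrossing d')) e∈ f∈ e≢f

  -- Convex parts and the union of drawings along a line

  module Lex (f g : Affine) where

    LexNonNeg LexNeg LexNonPos : V → Set (ℓ₁ ⊔ ℓ₂)
    LexNonNeg v = Pos (f ⟪ v ⟫) ⊎ (f ⟪ v ⟫ ≈ 0# × NonNeg (g ⟪ v ⟫))
    LexNeg v = Pos (- f ⟪ v ⟫) ⊎ (f ⟪ v ⟫ ≈ 0# × Pos (- g ⟪ v ⟫))
    LexNonPos v = Pos (- f ⟪ v ⟫) ⊎ (f ⟪ v ⟫ ≈ 0# × NonNeg (- g ⟪ v ⟫))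

    open Refinement pt

    separate : ∀ ws → ∃ λ h → ∀ {v} → v ∈ ws →
      (LexNonNeg v → Pos (h ⟪ v ⟫)) × (LexNeg v → Pos (- h ⟪ v ⟫))
    separate ws = proj₁ rf , λ v∈ → let r = proj₂ rf v∈ ; r' = proj₂ rg v∈ in
      (λ { (inj₁ p) → on-pos r p
         ; (inj₂ (z , inj₁ p)) → pos-resp (sym (on-zero r z)) (on-pos r' p)
         ; (inj₂ (z , inj₂ z')) → pos-resp (sym (trans (on-zero r z) (trans (on-zero r' z') (constant-⟨$⟩ 1# _)))) pos-1 })
      , (λ { (inj₁ p) → on-neg r p
           ; (inj₂ (z , p)) → pos-resp (-‿cong (sym (on-zero r z))) (on-neg r' p) })
      where
      -- The constant moves common zeros of `f` and `g` to the positive side, where `LexNonNeg`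
      -- counts them.
      rg = refine g (constant 1#) ws
      rf = refine f (proj₁ rg) ws

  -- Convexity relative to the vertices and to bichromatic segments: the blockers of all potential
  -- edges stay in the part.
  Convex : List V → Set (ℓ₁ ⊔ ℓ₂)
  Convex vs = ∀ {i j v} → inj₁ i ∈ vs → inj₂ j ∈ vs → InOpenSeg (pt v) (A i) (B j) → v ∈ vs

  -- One functional is positive on `us` and negative on the other vertices of `vs`; between two
  -- points where it is positive it remains positive.
  convex-part : ∀ f g {us vs} → Convex vs → us ⊆ vs →
    (∀ {v} → v ∈ us → Lex.LexNonNeg f g v) → (∀ {v} → v ∈ vs → v ∈ us ⊎ Lex.LexNeg f g v) → Convex us
  convex-part f g {us} {vs} convex us⊆vs us≥0 part {i} {j} {v} i∈ j∈ v-between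
    with part (convex (us⊆vs i∈) (us⊆vs j∈) v-between)
  ... | inj₁ v∈ = v∈
  ... | inj₂ v<0 = ⊥-elim (pos-neg
          (comb-pos h (closedSeg⇒comb (A≉B i j) (openSeg⇒closedSeg v-between))
            (proj₁ (h-sign (us⊆vs i∈)) (us≥0 i∈)) (proj₁ (h-sign (us⊆vs j∈)) (us≥0 j∈)))
          (proj₂ (h-sign {v} (convex (us⊆vs i∈) (us⊆vs j∈) v-between)) v<0))
    where
    h = proj₁ (Lex.separate f g vs)
    h-sign = proj₂ (Lex.separate f g vs)

  -- The edge lies in the closed half-plane of `h` and has at most one end on its border, so it can
  -- touch the border only in that end.
  zeroEnd : ∀ h e {q} → OnEdge q e → (∀ {w} → End w e → NonNeg (h ⟪ w ⟫)) →
    (∀ {u v} → End u e → End v e → h ⟪ u ⟫ ≈ 0# → h ⟪ v ⟫ ≈ 0# → u ≡ v) →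
    h ⟨$⟩ q ≈ 0# → ∃ λ w → End w e × h ⟪ w ⟫ ≈ 0# × q ≈p pt w
  zeroEnd h e@(i , j) {q} on h≥0 unique hq = go (h≥0 (inj₁ ≡.refl)) (h≥0 (inj₂ ≡.refl))
    where
    k = onEdge⇒comb e on
    go : NonNeg (h ⟪ inj₁ i ⟫) → NonNeg (h ⟪ inj₂ j ⟫) → ∃ λ w → End w e × h ⟪ w ⟫ ≈ 0# × q ≈p pt w
    go (inj₁ p) (inj₁ p') = ⊥-elim (pos⇒≉0 (comb-pos h k p p') hq)
    go (inj₁ p) (inj₂ z') = _ , inj₂ ≡.refl , z' , comb-vertex h (comb-swap k) hq z' (pos⇒≉0 p)
    go (inj₂ z) n = _ , inj₁ ≡.refl , z , comb-vertex h k hq z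
      (λ z' → contra (unique (inj₁ ≡.refl) (inj₂ ≡.refl) z z'))
      where
      contra : inj₁ i ≢ inj₂ j
      contra ()

  -- The separating functional is f, with its zeros decided by g; it may vanish at one common vertex.
  join : ∀ f g {us vs ws k l} → us ⊆ ws → vs ⊆ ws →
    (∀ {v} → v ∈ us → Lex.LexNonNeg f g v) → (∀ {v} → v ∈ vs → Lex.LexNonPos f g v) →
    (∀ {u v} → u ∈ ws → v ∈ ws → f ⟪ u ⟫ ≈ 0# → g ⟪ u ⟫ ≈ 0# → f ⟪ v ⟫ ≈ 0# → g ⟪ v ⟫ ≈ 0# → u ≡ v) →
    Drawing us k → Drawing vs l → Drawing ws (k ℕ.+ l)
  join f g {us} {vs} {ws} us⊆ws vs⊆ws us≥0 vs≤0 unique d d' = append d d' us⊆ws vs⊆ws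
    λ {e} {f'} e∈ f∈ → distinct (inside d e∈) (inside d' f∈) , noncrossing (inside d e∈) (inside d' f∈)
    where
    open Refinement pt f g
    h = proj₁ (refine ws)
    refines : ∀ {v} → v ∈ ws → Refines h v
    refines = proj₂ (refine ws)
    h-us : ∀ {v} → v ∈ us → NonNeg (h ⟪ v ⟫)
    h-us v∈ with us≥0 v∈
    ... | inj₁ p = inj₁ (on-pos (refines (us⊆ws v∈)) p)
    ... | inj₂ (z , n) = nonNeg-resp (sym (on-zero (refines (us⊆ws v∈)) z)) n
    h-vs : ∀ {v} → v ∈ vs → NonNeg (negate h ⟪ v ⟫)
    h-vs v∈ with vs≤0 v∈
    ... | inj₁ p = inj₁ (pos-resp (sym (negate-⟨$⟩ h _)) (on-neg (refines (vs⊆ws v∈)) p))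
    ... | inj₂ (z , n) = nonNeg-resp (trans (-‿cong (sym (on-zero (refines (vs⊆ws v∈)) z))) (sym (negate-⟨$⟩ h _))) n
    f-zero : ∀ {v} → v ∈ ws → h ⟪ v ⟫ ≈ 0# → f ⟪ v ⟫ ≈ 0#
    f-zero {v} v∈ z with sign (f ⟪ v ⟫)
    ... | pos p = ⊥-elim (pos⇒≉0 (on-pos (refines v∈) p) z)
    ... | zer z' = z'
    ... | neg n = ⊥-elim (pos⇒≉0 (on-neg (refines v∈) n) (-zero z))
    h-unique : ∀ {u v} → u ∈ ws → v ∈ ws → h ⟪ u ⟫ ≈ 0# → h ⟪ v ⟫ ≈ 0# → u ≡ v
    h-unique u∈ v∈ zu zv = unique u∈ v∈ (f-zero u∈ zu) (trans (sym (on-zero (refines u∈) (f-zero u∈ zu))) zu)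
      (f-zero v∈ zv) (trans (sym (on-zero (refines v∈) (f-zero v∈ zv))) zv)
    neg-zero : ∀ {q} → negate h ⟨$⟩ q ≈ 0# → h ⟨$⟩ q ≈ 0#
    neg-zero {q} z = trans (sym (-‿involutive _)) (-zero (trans (sym (negate-⟨$⟩ h q)) z))
    vanishes : ∀ {q} → NonNeg (h ⟨$⟩ q) → NonNeg (negate h ⟨$⟩ q) → h ⟨$⟩ q ≈ 0#
    vanishes (inj₂ z) _ = z
    vanishes (inj₁ p) n = ⊥-elim (pos⇒¬neg-nonNeg p (nonNeg-resp (negate-⟨$⟩ h _) n))
    -- Both ends of a shared edge would lie on the separating line, which carries one vertex at
    -- most.
    distinct : ∀ {e f} → Inside us e → Inside vs f → e ≢ f
    distinct {i , j} (i∈ , j∈) (i∈' , j∈') ≡.refl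
      with h-unique (us⊆ws i∈) (us⊆ws j∈) (vanishes (h-us i∈) (h-vs i∈')) (vanishes (h-us j∈) (h-vs j∈'))
    ... | ()
    noncrossing : ∀ {e f} → Inside us e → Inside vs f → NonCrossingPair e f
    noncrossing {e} {f} e-in f-in q qe qf = meet
      (zeroEnd h e qe (λ w → h-us (end∈ e e-in w))
        (λ u v → h-unique (us⊆ws (end∈ e e-in u)) (us⊆ws (end∈ e e-in v))) hq)
      (zeroEnd (negate h) f qf (λ w → h-vs (end∈ f f-in w))
        (λ u v zu zv → h-unique (vs⊆ws (end∈ f f-in u)) (vs⊆ws (end∈ f f-in v)) (neg-zero zu) (neg-zero zv))
        (trans (negate-⟨$⟩ h q) (-zero hq)))
      where
      -- A common point lies on both sides, hence on the line; there both edges can only have the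
      -- one vertex of the line.
      hq≥0 : NonNeg (h ⟨$⟩ q)
      hq≥0 = comb-nonNeg h (onEdge⇒comb e qe) (h-us (proj₁ e-in)) (h-us (proj₂ e-in))
      hq≤0 : NonNeg (negate h ⟨$⟩ q)
      hq≤0 = comb-nonNeg (negate h) (onEdge⇒comb f qf) (h-vs (proj₁ f-in)) (h-vs (proj₂ f-in))
      hq : h ⟨$⟩ q ≈ 0#
      hq = vanishes hq≥0 hq≤0
      meet : ∃ (λ w → End w e × h ⟪ w ⟫ ≈ 0# × q ≈p pt w) →
             ∃ (λ w → End w f × negate h ⟪ w ⟫ ≈ 0# × q ≈p pt w) → CommonEndpoint q e f
      meet (w , we , zw , q≈w) (w' , wf , zw' , _) = commonEnd e f we
        (≡.subst (λ v → End v f)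
          (≡.sym (h-unique (us⊆ws (end∈ e e-in we)) (vs⊆ws (end∈ f f-in wf)) zw (neg-zero zw'))) wf) q≈w

  -- A blocking vertex would be an end of a shorter bichromatic segment.
  shortestEdge : ∀ {vs i j} → Convex vs → inj₁ i ∈ vs → inj₂ j ∈ vs → Drawing vs 1
  shortestEdge {vs} {i₀} {j₀} convex i₀∈ j₀∈ = record
    { edges = e ∷ []
    ; nonCrossing = ([] ∷ []) , (λ { (here ≡.refl) → adjacent }) , λ { (here ≡.refl) (here ≡.refl) e≢e → ⊥-elim (e≢e ≡.refl) }
    ; inside = λ { (here ≡.refl) → e-in }
    ; enough = s≤s z≤n }
    where
    inside? : ∀ e → Dec (Inside vs e)
    inside? (i , j) = (inj₁ i ∈? vs) ×-dec (inj₂ j ∈? vs)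
    candidates = filter inside? (cartesianProduct (allFin n) (allFin n))
    candidate : ∀ {i j} → inj₁ i ∈ vs → inj₂ j ∈ vs → (i , j) ∈ candidates
    candidate {i} {j} i∈ j∈ = ∈-filter⁺ inside? (∈-cartesianProduct⁺ (∈-allFin i) (∈-allFin j)) (i∈ , j∈)
    len : Edge → Carrier
    len (i , j) = dist² (A i) (B j)
    -- `e ≡ e` serves as the predicate that always holds: lengths are comparable without
    -- restriction.
    open TotalPreorder {A = Edge} (λ e → e ≡ e) (λ e f → NonNeg (len f - len e))
      (λ {e} {f} _ _ → nonNeg-total (len f) (len e)) (λ _ _ _ p q → nonNeg-trans q p)
    least : ∃ λ m → m ∈ candidates × (∀ {e} → e ∈ candidates → NonNeg (len e - len m))
    least = minimum (candidate i₀∈ j₀∈) (All.universal (λ _ → ≡.refl) candidates)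
    e = proj₁ least
    i = proj₁ e
    j = proj₂ e
    e-in : Inside vs e
    e-in = proj₂ (∈-filter⁻ inside? {xs = cartesianProduct (allFin n) (allFin n)} (proj₁ (proj₂ least)))
    adjacent : Adjacent e
    adjacent v between = go v between (convex (proj₁ e-in) (proj₂ e-in) between)
      where
      go : ∀ v → InOpenSeg (pt v) (A i) (B j) → v ∈ vs → ⊥
      go (inj₁ k) between k∈ = pos⇒¬neg-nonNeg (openSeg-dist² (A≉B i j) between)
        (nonNeg-resp (sym (neg-swap _ _)) (proj₂ (proj₂ least) (candidate k∈ (proj₂ e-in))))
      go (inj₂ k) between k∈ = pos⇒¬neg-nonNeg (openSeg-dist² (A≉B i j ∘ ≈p-sym) (openSeg-sym between))
        (nonNeg-resp (trans (sym (neg-swap _ _)) (-‿cong (+-cong (dist²-sym _ _) (-‿cong (dist²-sym _ _)))))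
          (proj₂ (proj₂ least) (candidate (proj₁ e-in) k∈)))

  open Drawing

  -- Collinear sets and fans

  Col : List V → Set ℓ₁
  Col vs = ∀ {u v w} → u ∈ vs → v ∈ vs → w ∈ vs → orient (pt u) (pt v) (pt w) ≈ 0#

  col? : ∀ vs → Dec (Col vs)
  col? vs = map′
    (λ all u∈ v∈ w∈ → All.lookup (All.lookup (All.lookup all u∈) v∈) w∈)
    (λ col → All.tabulate λ u∈ → All.tabulate λ v∈ → All.tabulate λ w∈ → col u∈ v∈ w∈)
    (All.all? (λ u → All.all? (λ v → All.all? (λ w → orient (pt u) (pt v) (pt w) ≈0?) vs) vs) vs)

  pt-distinct : ∀ {u v} → u ≢ v → ¬ pt u ≈p pt v
  pt-distinct u≢v e = u≢v (pt-injective e)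

  collinear-through : ∀ {vs a b} → a ≢ b → (∀ {v} → v ∈ vs → orient (pt a) (pt b) (pt v) ≈ 0#) → Col vs
  collinear-through {a = a} {b} a≢b on u∈ v∈ w∈ =
    collinear-line {pt a} {pt b} (pt-distinct a≢b) (on u∈) (on v∈) (on w∈)

  col-∷ : ∀ {z vs a b} → Col vs → a ∈ vs → b ∈ vs → a ≢ b → orient (pt a) (pt b) (pt z) ≈ 0# → Col (z ∷ vs)
  col-∷ {z} {vs} {a} {b} col a∈ b∈ a≢b abz = collinear-through a≢b on
    where
    on : ∀ {v} → v ∈ z ∷ vs → orient (pt a) (pt b) (pt v) ≈ 0#
    on (here ≡.refl) = abz
    on (there v∈) = col a∈ b∈ v∈

  orient-cong₃ : ∀ p r {q q'} → q ≈p q' → orient p r q ≈ orient p r q'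
  orient-cong₃ p r {q} {q'} e = trans (sym (through-⟨$⟩ p r q)) (trans (⟨$⟩-cong (through p r) e) (through-⟨$⟩ p r q'))

  openSeg-cong : ∀ {q q' p r} → q ≈p q' → InOpenSeg q p r → InOpenSeg q' p r
  openSeg-cong {q} {q'} {p} {r} (ex , ey) (z , b) =
    trans (sym (orient-cong₃ p r (ex , ey))) z ,
    pos-resp (+-cong (*-cong (+-congʳ ex) (+-congˡ (-‿cong ex))) (*-cong (+-congʳ ey) (+-congˡ (-‿cong ey)))) b

  -- An edge lists its end in `A` first. `Joins` reads it from apex to leaf, whichever colour the
  -- apex has.
  record Joins (z l : V) (e : Edge) : Set (c ⊔ ℓ₁ ⊔ ℓ₂) where
    field
      endˡ    : End z e
      endʳ    : End l e
      ends    : ∀ {w} → End w e → w ≡ z ⊎ w ≡ l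
      comb-zl : ∀ {q} → OnEdge q e → Comb q (pt z) (pt l)
      open-zl : ∀ {q} → InOpenSeg q (A (proj₁ e)) (B (proj₂ e)) → InOpenSeg q (pt z) (pt l)
  open Joins

  ray : V → V → List Edge
  ray (inj₁ i) (inj₁ _) = []
  ray (inj₁ i) (inj₂ j) = (i , j) ∷ []
  ray (inj₂ j) (inj₁ i) = (i , j) ∷ []
  ray (inj₂ j) (inj₂ _) = []

  ray-joins : ∀ z l {e} → e ∈ ray z l → Joins z l e
  ray-joins (inj₁ i) (inj₂ j) (here ≡.refl) = record
    { endˡ = inj₁ ≡.refl ; endʳ = inj₂ ≡.refl ; ends = id
    ; comb-zl = onEdge⇒comb (i , j) ; open-zl = id }
  ray-joins (inj₂ j) (inj₁ i) (here ≡.refl) = record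
    { endˡ = inj₂ ≡.refl ; endʳ = inj₁ ≡.refl ; ends = λ { (inj₁ e) → inj₂ e ; (inj₂ e) → inj₁ e }
    ; comb-zl = λ on → comb-swap (onEdge⇒comb (i , j) on) ; open-zl = openSeg-sym }

  ray-unique : ∀ z l → Unique (ray z l)
  ray-unique (inj₁ i) (inj₁ _) = []
  ray-unique (inj₁ i) (inj₂ j) = [] ∷ []
  ray-unique (inj₂ j) (inj₁ i) = [] ∷ []
  ray-unique (inj₂ j) (inj₂ _) = []

  length-ray : ∀ z l → length (ray z l) ≡ indicator (not (colour z)) (colour l)
  length-ray (inj₁ i) (inj₁ _) = ≡.refl
  length-ray (inj₁ i) (inj₂ j) = ≡.refl
  length-ray (inj₂ j) (inj₁ i) = ≡.refl
  length-ray (inj₂ j) (inj₂ _) = ≡.refl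

  star : V → List V → List Edge
  star z [] = []
  star z (l ∷ ls) = ray z l ++ star z ls

  star⁻ : ∀ z ls {e} → e ∈ star z ls → ∃ λ l → l ∈ ls × e ∈ ray z l
  star⁻ z (l ∷ ls) e∈ with ∈-++⁻ (ray z l) e∈
  ... | inj₁ e∈ray = l , here ≡.refl , e∈ray
  ... | inj₂ e∈star = let l' , l'∈ , e∈ray = star⁻ z ls e∈star in l' , there l'∈ , e∈ray

  length-star : ∀ z ls → length (star z ls) ≡ count (not (colour z)) ls
  length-star z [] = ≡.refl
  length-star z (l ∷ ls) = ≡.trans (Listₚ.length-++ (ray z l)) (≡.cong₂ ℕ._+_ (length-ray z l) (length-star z ls))

  ray-endpoint : ∀ {z l l' e} → l ≢ z → e ∈ ray z l → e ∈ ray z l' → l ≡ l'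
  ray-endpoint {z} {l} {l'} l≢z e∈ e∈' with ends (ray-joins z l' e∈') (endʳ (ray-joins z l e∈))
  ... | inj₁ l≡z = ⊥-elim (l≢z l≡z)
  ... | inj₂ l≡l' = l≡l'

  ray-singleton : ∀ {z l e f} → e ∈ ray z l → f ∈ ray z l → e ≡ f
  ray-singleton {inj₁ _} {inj₂ _} (here ≡.refl) (here ≡.refl) = ≡.refl
  ray-singleton {inj₂ _} {inj₁ _} (here ≡.refl) (here ≡.refl) = ≡.refl

  star-unique : ∀ z {ls} → z ∉ ls → Unique ls → Unique (star z ls)
  star-unique z z∉ [] = []
  star-unique z {l ∷ ls} z∉ (l∉ ∷ unique) = Uniqueₚ.++⁺ (ray-unique z l) (star-unique z (z∉ ∘ there) unique)
    λ (e∈ , e∈') → let l' , l'∈ , e∈ray = star⁻ z ls e∈' in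
      All.lookup l∉ l'∈ (ray-endpoint (λ l≡z → z∉ (here (≡.sym l≡z))) e∈ e∈ray)

  length≥2 : ∀ {z ls} → ¬ Col (z ∷ ls) → 2 ℕ.≤ length ls
  length≥2 {z} {[]} ¬col = ⊥-elim (¬col λ { (here ≡.refl) (here ≡.refl) _ → orient-ppq (pt z) _ })
  length≥2 {z} {l ∷ []} ¬col = ⊥-elim (¬col λ
    { (here ≡.refl) (here ≡.refl) _ → orient-ppq (pt z) _
    ; (here ≡.refl) (there (here ≡.refl)) (here ≡.refl) → orient-pqp (pt z) (pt l)
    ; (here ≡.refl) (there (here ≡.refl)) (there (here ≡.refl)) → orient-pqq (pt z) (pt l)
    ; (there (here ≡.refl)) (here ≡.refl) (here ≡.refl) → orient-pqq (pt l) (pt z)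
    ; (there (here ≡.refl)) (here ≡.refl) (there (here ≡.refl)) → orient-pqp (pt l) (pt z)
    ; (there (here ≡.refl)) (there (here ≡.refl)) _ → orient-ppq (pt l) _ })
  length≥2 {z} {_ ∷ _ ∷ _} _ = s≤s (s≤s z≤n)

  bichromatic⇒edge : ∀ {vs} c → Convex vs → 1 ℕ.≤ count c vs → 1 ℕ.≤ count (not c) vs → Drawing vs 1
  bichromatic⇒edge true convex p q with count-member true _ p | count-member false _ q
  ... | inj₁ _ , u∈ , _ | inj₂ _ , v∈ , _ = shortestEdge convex u∈ v∈
  bichromatic⇒edge false convex p q with count-member true _ q | count-member false _ p
  ... | inj₁ _ , u∈ , _ | inj₂ _ , v∈ , _ = shortestEdge convex u∈ v∈

  -- Covers the sets in which all vertices but `z` lie on a line missing `z`, where the induction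
  -- hypothesis does not apply to `ls`. Each line through `z` meets `ls` at most once, so nothing
  -- blocks the rays and they meet only in `z`.
  module Fan {z : V} {ls : List V} (z∉ls : z ∉ ls) (unique : Unique ls) (convex : Convex (z ∷ ls))
             (col : Col ls) (¬col : ¬ Col (z ∷ ls)) where

    apex : ∀ {l l'} → l ∈ ls → l' ∈ ls → l ≢ l' → ¬ orient (pt l) (pt l') (pt z) ≈ 0#
    apex l∈ l'∈ l≢l' e = ¬col (col-∷ col l∈ l'∈ l≢l' e)

    apex' : ∀ {l l'} → l ∈ ls → l' ∈ ls → l ≢ l' → ¬ orient (pt z) (pt l) (pt l') ≈ 0#
    apex' {l} {l'} l∈ l'∈ l≢l' e = apex l∈ l'∈ l≢l' (trans (orient-cycle (pt z) (pt l) (pt l')) e)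

    fan : Drawing (z ∷ ls) (count (not (colour z)) ls)
    fan = record
      { edges = star z ls
      ; nonCrossing = star-unique z z∉ls unique , adjacent , noncrossing
      ; inside = in-star
      ; enough = ℕₚ.≤-reflexive (≡.sym (length-star z ls)) }
      where
      in-star : ∀ {e} → e ∈ star z ls → Inside (z ∷ ls) e
      in-star e∈ with star⁻ z ls e∈
      ... | l , l∈ , e∈ray = member (ends j (inj₁ ≡.refl)) , member (ends j (inj₂ ≡.refl))
        where
        j = ray-joins z l e∈ray
        member : ∀ {w} → w ≡ z ⊎ w ≡ l → w ∈ z ∷ ls
        member (inj₁ ≡.refl) = here ≡.refl
        member (inj₂ ≡.refl) = there l∈
      adjacent : ∀ {e} → e ∈ star z ls → Adjacent e
      adjacent e∈ v between with star⁻ z ls e∈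
      ... | l , l∈ , e∈ray = go {v} (convex (proj₁ (in-star e∈)) (proj₂ (in-star e∈)) between)
                                (open-zl (ray-joins z l e∈ray) between)
        where
        go : ∀ {v} → v ∈ z ∷ ls → InOpenSeg (pt v) (pt z) (pt l) → ⊥
        go (here ≡.refl) (_ , b) = pos⇒≉0 b (betw-ppq (pt z) (pt l))
        go {v} (there v∈) (o , b) with l ≟V v
        ... | yes ≡.refl = pos⇒≉0 b (betw-pqq (pt z) (pt l))
        ... | no l≢v = apex' l∈ v∈ l≢v o
      noncrossing : ∀ {e f} → e ∈ star z ls → f ∈ star z ls → e ≢ f → NonCrossingPair e f
      noncrossing {e} {f} e∈ f∈ e≢f q qe qf with star⁻ z ls e∈ | star⁻ z ls f∈
      ... | l , l∈ , e∈ray | l' , l'∈ , f∈ray = commonEnd e f (endˡ je) (endˡ jf)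
          (comb-vertex h (comb-zl jf qf) hq (trans (h-eval (pt z)) (orient-pqp (pt z) (pt l)))
            (λ e → apex' l∈ l'∈ l≢l' (trans (sym (h-eval (pt l'))) e)))
        where
        je = ray-joins z l e∈ray
        jf = ray-joins z l' f∈ray
        h = through (pt z) (pt l)
        h-eval = through-⟨$⟩ (pt z) (pt l)
        hq : h ⟨$⟩ q ≈ 0#
        hq = comb-zero h (comb-zl je qe) (trans (h-eval (pt z)) (orient-pqp (pt z) (pt l)))
          (trans (h-eval (pt l)) (orient-pqq (pt z) (pt l)))
        l≢l' : l ≢ l'
        l≢l' ≡.refl = e≢f (ray-singleton {z} {l} e∈ray f∈ray)

    base-convex : Convex ls
    base-convex {i} {j} {v} i∈ j∈ between with convex {v = v} (there i∈) (there j∈) between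
    ... | here ≡.refl = ⊥-elim (apex i∈ j∈ (λ ()) (proj₁ between))
    ... | there v∈ = v∈

    -- A ray reaches the line of `ls` only at its leaf, and a leaf that lies on a visible base edge
    -- is one of its ends.
    fan+base : Drawing ls 1 → Drawing (z ∷ ls) (count (not (colour z)) ls ℕ.+ 1)
    fan+base d = append fan d id there compatible
      where
      compatible : ∀ {e f} → e ∈ star z ls → f ∈ edges d → e ≢ f × NonCrossingPair e f
      compatible {e} {f@(i , j)} e∈ f∈ with star⁻ z ls e∈
      ... | l , l∈ , e∈ray = e≢f , noncrossing
        where
        je = ray-joins z l e∈ray
        i∈ = proj₁ (inside d f∈)
        j∈ = proj₂ (inside d f∈)
        e≢f : e ≢ f
        e≢f ≡.refl = z∉ls (end∈ f (inside d f∈) (endˡ je))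
        h = through (A i) (B j)
        h-eval = through-⟨$⟩ (A i) (B j)
        noncrossing : NonCrossingPair e f
        noncrossing q qe qf = go (closedSeg-end (A≉B i j) qf not-between)
          where
          q≈l : q ≈p pt l
          q≈l = comb-vertex h (comb-swap (comb-zl je qe)) (trans (h-eval q) (proj₁ qf))
            (trans (h-eval (pt l)) (col i∈ j∈ l∈))
            (λ e → apex i∈ j∈ (λ ()) (trans (sym (h-eval (pt z))) e))
          not-between : ¬ InOpenSeg q (A i) (B j)
          not-between between = proj₁ (proj₂ (nonCrossing d)) f∈ l (openSeg-cong q≈l between)
          go : q ≈p A i ⊎ q ≈p B j → CommonEndpoint q e f
          go (inj₁ q≈) = commonEnd e f (endʳ je) (inj₁ (pt-injective (≈p-trans (≈p-sym q≈l) q≈))) q≈l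
          go (inj₂ q≈) = commonEnd e f (endʳ je) (inj₂ (pt-injective (≈p-trans (≈p-sym q≈l) q≈))) q≈l

    -- The star has at least `suc k` edges, as `z` does not count for the other colour. If the
    -- colour of `z` recurs in `ls`, a base edge supplies the missing one. Otherwise `k` is 0, and
    -- the star reaches every vertex of `ls`, of which there are at least two.
    fan-drawing : ∀ k → (∀ c → suc k ℕ.≤ count c (z ∷ ls)) → Drawing (z ∷ ls) (suc (suc k))
    fan-drawing k enough with 1 ℕ.≤? count (colour z) ls
    ... | yes mono = weaken id (ℕₚ.≤-trans (s≤s opp≥) (ℕₚ.≤-reflexive (ℕₚ.+-comm 1 _)))
            (fan+base (bichromatic⇒edge (colour z) base-convex mono (ℕₚ.≤-trans (s≤s z≤n) opp≥)))
      where
      opp≥ : suc k ℕ.≤ count (not (colour z)) ls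
      opp≥ = ≡.subst (λ i → suc k ℕ.≤ i ℕ.+ count (not (colour z)) ls) (indicator-other (colour z)) (enough (not (colour z)))
    ... | no none = weaken id (ℕₚ.≤-trans (s≤s (s≤s k≤0)) opp≥2) fan
      where
      zero-count : count (colour z) ls ≡ 0
      zero-count = ℕₚ.n≤0⇒n≡0 (ℕₚ.≤-pred (ℕₚ.≰⇒> none))
      k≤0 : k ℕ.≤ 0
      k≤0 = ℕₚ.≤-pred (≡.subst₂ (λ i j → suc k ℕ.≤ i ℕ.+ j) (indicator-same (colour z)) zero-count (enough (colour z)))
      opp≥2 : 2 ℕ.≤ count (not (colour z)) ls
      opp≥2 = ≡.subst (2 ℕ.≤_) (≡.trans (≡.sym (count-sum (colour z) ls)) (≡.cong (ℕ._+ count (not (colour z)) ls) zero-count)) (length≥2 ¬col)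

  -- Inner common tangents

  module Separated (ps qs : List V) (h : Affine)
    (h-ps : ∀ {v} → v ∈ ps → Pos (- h ⟪ v ⟫)) (h-qs : ∀ {v} → v ∈ qs → Pos (h ⟪ v ⟫)) where

    rising : ∀ {u v} → u ∈ ps → v ∈ qs → Pos (linear h (vec (pt u) (pt v)))
    rising u∈ v∈ = pos-resp (sym (linear-vec h _ _)) (pos-+ (h-qs v∈) (h-ps u∈))

    disjoint : ∀ {v} → v ∈ ps → v ∉ qs
    disjoint u∈ v∈ = pos-neg (h-qs v∈) (h-ps u∈)

    -- One of the two inner common tangents yz of the convex hulls, with y and z as close
    -- as possible.
    record Tangent (b : Bool) : Set (ℓ₁ ⊔ ℓ₂) where
      field
        y z : V
        y∈  : y ∈ ps
        z∈  : z ∈ qs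
      f : Affine
      f = signedThrough b (pt y) (pt z)
      field
        f-ps : ∀ {v} → v ∈ ps → Pos (f ⟪ v ⟫) ⊎ (f ⟪ v ⟫ ≈ 0# × NonNeg (h ⟪ y ⟫ - h ⟪ v ⟫))
        f-qs : ∀ {v} → v ∈ qs → Pos (- f ⟪ v ⟫) ⊎ (f ⟪ v ⟫ ≈ 0# × NonNeg (h ⟪ v ⟫ - h ⟪ z ⟫))

      f-eval : ∀ v → f ⟪ v ⟫ ≈ signed b (orient (pt y) (pt z) (pt v))
      f-eval v = signedThrough-⟨$⟩ b (pt y) (pt z) (pt v)

      f⇒orient : ∀ v → f ⟪ v ⟫ ≈ 0# → orient (pt y) (pt z) (pt v) ≈ 0#
      f⇒orient v e = signed-zero⁻ b (trans (sym (f-eval v)) e)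

      orient⇒f : ∀ v → orient (pt y) (pt z) (pt v) ≈ 0# → f ⟪ v ⟫ ≈ 0#
      orient⇒f v e = trans (f-eval v) (signed-zero b e)

      f-y : f ⟪ y ⟫ ≈ 0#
      f-y = orient⇒f y (orient-pqp (pt y) (pt z))

      f-z : f ⟪ z ⟫ ≈ 0#
      f-z = orient⇒f z (orient-pqq (pt y) (pt z))

      y≢z : y ≢ z
      y≢z y≡z = disjoint y∈ (≡.subst (_∈ qs) (≡.sym y≡z) z∈)

    OnLine : Affine → List V → Set ℓ₁
    OnLine f vs = ∀ {v} → v ∈ vs → f ⟪ v ⟫ ≈ 0#

    onLine? : ∀ f vs → Dec (OnLine f vs)
    onLine? f vs = map′ (λ all v∈ → All.lookup all v∈) (λ on → All.tabulate on) (All.all? (λ v → (f ⟪ v ⟫) ≈0?) vs)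

    -- Of all segments from `ps` to `qs`, `yz` is the first in angular order: a vertex on the wrong
    -- side would give an earlier segment with `y` or `z`. Ties go to the smallest rise of `h`,
    -- which makes `y` the highest vertex of `ps` and `z` the lowest of `qs` on the tangent.
    tangent : ∀ b {u v} → u ∈ ps → v ∈ qs → Tangent b
    tangent b {u} {v} u∈ v∈ = record
      { y = y ; z = z ; y∈ = y∈ ; z∈ = z∈
      ; f-ps = λ {v} v∈ → for-ps v (least (∈-cartesianProduct⁺ v∈ z∈))
      ; f-qs = λ {v} v∈ → for-qs v (least (∈-cartesianProduct⁺ y∈ v∈)) }
      where
      open Angular b (linear h)
      segment : V × V → Point
      segment (u , v) = vec (pt u) (pt v)
      open TotalPreorder {A = V × V} (λ e → Pos (linear h (segment e))) (λ e e' → segment e ⊑ segment e')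
        (λ {e} {e'} _ _ → ⊑-total (segment e) (segment e')) (λ p q r → ⊑-trans h p q r)
      min : ∃ λ m → m ∈ cartesianProduct ps qs × (∀ {e} → e ∈ cartesianProduct ps qs → segment m ⊑ segment e)
      min = minimum (∈-cartesianProduct⁺ u∈ v∈)
        (All.tabulate λ e∈ → let u∈ , v∈ = ∈-cartesianProduct⁻ ps qs e∈ in rising u∈ v∈)
      y = proj₁ (proj₁ min)
      z = proj₂ (proj₁ min)
      y∈ = proj₁ (∈-cartesianProduct⁻ ps qs (proj₁ (proj₂ min)))
      z∈ = proj₂ (∈-cartesianProduct⁻ ps qs (proj₁ (proj₂ min)))
      least = proj₂ (proj₂ min)
      f-eval = signedThrough-⟨$⟩ b (pt y) (pt z)
      for-ps : ∀ v → segment (y , z) ⊑ segment (v , z) →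
        Pos (signedThrough b (pt y) (pt z) ⟪ v ⟫) ⊎
        (signedThrough b (pt y) (pt z) ⟪ v ⟫ ≈ 0# × NonNeg (h ⟪ y ⟫ - h ⟪ v ⟫))
      for-ps v (inj₁ p) = inj₁ (pos-resp (trans (cross-to b (pt y) (pt z) (pt v)) (sym (f-eval (pt v)))) p)
      for-ps v (inj₂ (e , m)) = inj₂
        ( trans (f-eval (pt v)) (trans (sym (cross-to b (pt y) (pt z) (pt v))) e)
        , nonNeg-resp (trans (+-cong (linear-vec h _ _) (-‿cong (linear-vec h _ _))) (cancel (h ⟪ z ⟫) (h ⟪ v ⟫) (h ⟪ y ⟫))) m)
        where
        cancel : ∀ z v y → (z - v) - (z - y) ≈ y - v
        cancel = solve 3 (λ z v y → (z :- v) :- (z :- y) := y :- v)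
      for-qs : ∀ v → segment (y , z) ⊑ segment (y , v) →
        Pos (- signedThrough b (pt y) (pt z) ⟪ v ⟫) ⊎
        (signedThrough b (pt y) (pt z) ⟪ v ⟫ ≈ 0# × NonNeg (h ⟪ v ⟫ - h ⟪ z ⟫))
      for-qs v (inj₁ p) = inj₁ (pos-resp (trans (cross-from b (pt y) (pt z) (pt v)) (-‿cong (sym (f-eval (pt v))))) p)
      for-qs v (inj₂ (e , m)) = inj₂
        ( trans (f-eval (pt v)) (trans (sym (-‿involutive _)) (-zero (trans (sym (cross-from b (pt y) (pt z) (pt v))) e)))
        , nonNeg-resp (trans (+-cong (linear-vec h _ _) (-‿cong (linear-vec h _ _))) (cancel (h ⟪ v ⟫) (h ⟪ y ⟫) (h ⟪ z ⟫))) m)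
        where
        cancel : ∀ v y z → (v - y) - (z - y) ≈ v - z
        cancel = solve 3 (λ v y z → (v :- y) :- (z :- y) := v :- z)

    opposite-signs : ∀ {d d' x w} → Pos d → Pos d' → d * x ≈ d' * w → NonNeg x → NonNeg (- w) → w ≈ 0#
    opposite-signs {d} {d'} {x} {w} pd pd' e x≥0 (inj₁ w<0) = ⊥-elim (pos⇒¬neg-nonNeg (*-pos pd' w<0)
      (nonNeg-resp (trans e (trans (sym (-‿involutive _)) (-‿cong (*-neg d' w)))) (nonNeg-* (inj₁ pd) x≥0)))
    opposite-signs pd pd' e x≥0 (inj₂ z) = trans (sym (-‿involutive _)) (-zero z)

    -- If both tangents pass through two vertices a and b they coincide, and then
    -- every vertex lies on both sides of the common line.
    coincide : (t : Tangent true) (t' : Tangent false) → ∀ {a b} → a ≢ b →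
      Tangent.f t ⟪ a ⟫ ≈ 0# → Tangent.f t ⟪ b ⟫ ≈ 0# → Tangent.f t' ⟪ a ⟫ ≈ 0# → Tangent.f t' ⟪ b ⟫ ≈ 0# →
      Col (ps ++ qs)
    coincide t t' {a} {b} a≢b ta tb t'a t'b = collinear-through {a = T.y} {b = T.z} T.y≢z
      λ v∈ → [ on-ps , on-qs ]′ (∈-++⁻ ps v∈)
      where
      module T = Tangent t
      module T' = Tangent t'
      ab : ∀ {y z} → y ≢ z → orient (pt y) (pt z) (pt a) ≈ 0# → orient (pt y) (pt z) (pt b) ≈ 0# →
           orient (pt a) (pt b) (pt y) ≈ 0# × orient (pt a) (pt b) (pt z) ≈ 0#
      ab {y} {z} y≢z ya yb =
        collinear-line {pt y} {pt z} (pt-distinct y≢z) ya yb (orient-pqp (pt y) (pt z)) ,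
        collinear-line {pt y} {pt z} (pt-distinct y≢z) ya yb (orient-pqq (pt y) (pt z))
      yz = ab T.y≢z (T.f⇒orient a ta) (T.f⇒orient b tb)
      y'z' = ab T'.y≢z (T'.f⇒orient a t'a) (T'.f⇒orient b t'b)
      proportional : ∀ v → linear h (vec (pt T.y) (pt T.z)) * orient (pt T'.y) (pt T'.z) (pt v)
                         ≈ linear h (vec (pt T'.y) (pt T'.z)) * orient (pt T.y) (pt T.z) (pt v)
      proportional v = same-line h (pt T.y) (pt T.z) (pt T'.y) (pt T'.z) (pt v)
        (collinear-line {pt a} {pt b} (pt-distinct a≢b) (proj₁ yz) (proj₂ yz) (proj₁ y'z'))
        (collinear-line {pt a} {pt b} (pt-distinct a≢b) (proj₁ yz) (proj₂ yz) (proj₂ y'z'))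
      weaken-ps : ∀ {x z} → Pos x ⊎ (x ≈ 0# × z) → NonNeg x
      weaken-ps (inj₁ p) = inj₁ p
      weaken-ps (inj₂ (z , _)) = inj₂ z
      weaken-qs : ∀ {x z} → Pos (- x) ⊎ (x ≈ 0# × z) → NonNeg (- x)
      weaken-qs (inj₁ p) = inj₁ p
      weaken-qs (inj₂ (z , _)) = inj₂ (-zero z)
      -- The tangents turn in opposite senses, so one bounds the orientation of `v` from above and
      -- the other from below by zero, up to a positive factor.
      on-ps : ∀ {v} → v ∈ ps → orient (pt T.y) (pt T.z) (pt v) ≈ 0#
      on-ps {v} v∈ = opposite-signs (rising T.y∈ T.z∈) (rising T'.y∈ T'.z∈) (proportional v)
        (nonNeg-resp (T'.f-eval v) (weaken-ps (T'.f-ps v∈)))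
        (nonNeg-resp (T.f-eval v) (weaken-ps (T.f-ps v∈)))
      on-qs : ∀ {v} → v ∈ qs → orient (pt T.y) (pt T.z) (pt v) ≈ 0#
      on-qs {v} v∈ = trans (sym (-‿involutive _)) (-zero
        (opposite-signs (rising T.y∈ T.z∈) (rising T'.y∈ T'.z∈)
          (trans (sym (*-neg _ _)) (trans (-‿cong (proportional v)) (*-neg _ _)))
          (nonNeg-resp (-‿cong (T'.f-eval v)) (weaken-qs (T'.f-qs v∈)))
          (nonNeg-resp (-‿cong (T.f-eval v)) (weaken-qs (T.f-qs v∈)))))

    -- If both tangents contain a whole part, they share two vertices and `coincide` applies: two
    -- vertices of the same part, or, if one contains `ps` and the other `qs`, an end of each.
    goodTangent : ¬ Col (ps ++ qs) →
      ∀ {p p'} → p ∈ ps → p' ∈ ps → p ≢ p' → ∀ {q q'} → q ∈ qs → q' ∈ qs → q ≢ q' →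
      ∃ λ b → Σ (Tangent b) λ t → ¬ OnLine (Tangent.f t) ps × ¬ OnLine (Tangent.f t) qs
    goodTangent ¬col {p} {p'} p∈ p'∈ p≢p' {q} {q'} q∈ q'∈ q≢q' =
      choose (onLine? T.f ps) (onLine? T.f qs) (onLine? T'.f ps) (onLine? T'.f qs)
      where
      t = tangent true p∈ q∈
      t' = tangent false p∈ q∈
      module T = Tangent t
      module T' = Tangent t'
      cross-pair : ∀ {u v} → u ∈ ps → v ∈ qs → u ≢ v
      cross-pair u∈ v∈ ≡.refl = disjoint u∈ v∈
      choose : Dec (OnLine T.f ps) → Dec (OnLine T.f qs) → Dec (OnLine T'.f ps) → Dec (OnLine T'.f qs) →
        ∃ λ b → Σ (Tangent b) λ t → ¬ OnLine (Tangent.f t) ps × ¬ OnLine (Tangent.f t) qs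
      choose (no ¬p) (no ¬q) _ _ = true , t , ¬p , ¬q
      choose _ _ (no ¬p) (no ¬q) = false , t' , ¬p , ¬q
      choose (yes P) _ (yes P') _ = ⊥-elim (¬col (coincide t t' p≢p' (P p∈) (P p'∈) (P' p∈) (P' p'∈)))
      choose (yes P) _ _ (yes Q') = ⊥-elim (¬col (coincide t t' (cross-pair T'.y∈ T.z∈) (P T'.y∈) T.f-z T'.f-y (Q' T.z∈)))
      choose _ (yes Q) (yes P') _ = ⊥-elim (¬col (coincide t t' (cross-pair T.y∈ T'.z∈) T.f-y (Q T'.z∈) (P' T.y∈) T'.f-z))
      choose _ (yes Q) _ (yes Q') = ⊥-elim (¬col (coincide t t' q≢q' (Q q∈) (Q q'∈) (Q' q∈) (Q' q'∈)))

  -- Splitting along a tangent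

  private module Permₛ = PermₛProperties (≡.setoid V)

  -- The minimum of the counts enters through a lower bound `suc k`; that it is a successor says
  -- that both colours occur.
  Claim : List V → Set (c ⊔ ℓ₁ ⊔ ℓ₂)
  Claim vs = Unique vs → Convex vs → ¬ Col vs → ∀ k → (∀ c → suc k ℕ.≤ count c vs) → Drawing vs (suc (suc k))

  LexPos : Affine → Affine → V → Set (ℓ₁ ⊔ ℓ₂)
  LexPos f g v = Pos (f ⟪ v ⟫) ⊎ (f ⟪ v ⟫ ≈ 0# × Pos (g ⟪ v ⟫))

  negate-pos : ∀ h v → Pos (- h ⟪ v ⟫) → Pos (negate h ⟪ v ⟫)
  negate-pos h v = pos-resp (sym (negate-⟨$⟩ h (pt v)))

  negate-neg : ∀ h v → Pos (h ⟪ v ⟫) → Pos (- negate h ⟪ v ⟫)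
  negate-neg h v = pos-resp (sym (trans (-‿cong (negate-⟨$⟩ h (pt v))) (-‿involutive _)))

  negate-zero : ∀ h v → h ⟪ v ⟫ ≈ 0# → negate h ⟪ v ⟫ ≈ 0#
  negate-zero h v z = trans (negate-⟨$⟩ h (pt v)) (-zero z)

  distinct-members : ∀ {vs : List V} → Unique vs → 2 ℕ.≤ length vs → ∃ λ u → ∃ λ v → u ∈ vs × v ∈ vs × u ≢ v
  distinct-members {u ∷ []} _ (s≤s ())
  distinct-members {u ∷ v ∷ _} ((u≢v ∷ _) ∷ _) _ = u , v , here ≡.refl , there (here ≡.refl) , u≢v

  convex-resp : ∀ {us vs} → us ⊆ vs → vs ⊆ us → Convex us → Convex vs
  convex-resp us⊆vs vs⊆us convex {v = v} i∈ j∈ between = us⊆vs (convex {v = v} (vs⊆us i∈) (vs⊆us j∈) between)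

  col-⊆ : ∀ {us vs} → us ⊆ vs → Col vs → Col us
  col-⊆ us⊆vs col u∈ v∈ w∈ = col (us⊆vs u∈) (us⊆vs v∈) (us⊆vs w∈)

  unique-resp-↭ : ∀ {us vs : List V} → us ↭ vs → Unique us → Unique vs
  unique-resp-↭ us↭vs = Permₛ.Unique-resp-↭ (↭⇒↭ₛ us↭vs)

  unique-∷ : ∀ {z : V} {vs} → z ∉ vs → Unique vs → Unique (z ∷ vs)
  unique-∷ z∉ unique = All.tabulate (λ v∈ z≡v → z∉ (≡.subst (_∈ _) (≡.sym z≡v) v∈)) ∷ unique

  module Split {ps qs : List V} (unique-ps : Unique ps) (unique-qs : Unique qs) (convex : Convex (ps ++ qs))
    (¬col : ¬ Col (ps ++ qs)) (h : Affine)
    (h-ps : ∀ {v} → v ∈ ps → Pos (- h ⟪ v ⟫)) (h-qs : ∀ {v} → v ∈ qs → Pos (h ⟪ v ⟫))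
    (m : ℕ) (balanced : ∀ c → count c ps ≡ suc m)
    (IH : ∀ vs → length vs ℕ.< length (ps ++ qs) → Claim vs) where

    open Separated ps qs h h-ps h-qs

    ⊆ˡ : ps ⊆ ps ++ qs
    ⊆ˡ = ∈-++⁺ˡ

    ⊆ʳ : qs ⊆ ps ++ qs
    ⊆ʳ = ∈-++⁺ʳ ps

    convex-ps : Convex ps
    convex-ps = convex-part (negate h) (constant 0#) convex ⊆ˡ (λ {v} v∈ → inj₁ (negate-pos h v (h-ps v∈)))
      λ {v} v∈ → [ inj₁ , (λ v∈ → inj₂ (inj₁ (negate-neg h v (h-qs v∈)))) ]′ (∈-++⁻ ps v∈)

    convex-qs : Convex qs
    convex-qs = convex-part h (constant 0#) convex ⊆ʳ (λ v∈ → inj₁ (h-qs v∈))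
      λ v∈ → [ (λ v∈ → inj₂ (inj₁ (h-ps v∈))) , inj₁ ]′ (∈-++⁻ ps v∈)

    length-ps : length ps ≡ suc m ℕ.+ suc m
    length-ps = ≡.trans (≡.sym (count-sum true ps)) (≡.cong₂ ℕ._+_ (balanced true) (balanced false))

    2≤ps : 2 ℕ.≤ length ps
    2≤ps = ≡.subst (2 ℕ.≤_) (≡.sym length-ps) (s≤s (ℕₚ.≤-trans (s≤s z≤n) (ℕₚ.m≤n+m (suc m) m)))

    enough-ps : ∀ c → suc m ℕ.≤ count c ps
    enough-ps c = ℕₚ.≤-reflexive (≡.sym (balanced c))

    module Along (2≤qs : 2 ℕ.≤ length qs) {b : Bool} (t : Tangent b)
      (¬on-ps : ¬ OnLine (Tangent.f t) ps) (¬on-qs : ¬ OnLine (Tangent.f t) qs) where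

      open Tangent t

      private
        -- A part stays smaller than the whole after receiving one vertex because the other part has
        -- at least two.
        size : ∀ {a b} → a ℕ.+ b ≡ length (ps ++ qs) → 2 ℕ.≤ b → suc a ℕ.< length (ps ++ qs)
        size {a} {b} e 2≤b = ℕₚ.≤-trans (ℕₚ.≤-trans (ℕₚ.≤-reflexive (ℕₚ.+-comm 2 a)) (ℕₚ.+-monoʳ-≤ a 2≤b)) (ℕₚ.≤-reflexive e)

        total : length ps ℕ.+ length qs ≡ length (ps ++ qs)
        total = ≡.sym (Listₚ.length-++ ps)

        small-ps : suc (length ps) ℕ.< length (ps ++ qs)
        small-ps = size total 2≤qs

        small-qs : suc (length qs) ℕ.< length (ps ++ qs)
        small-qs = size (≡.trans (ℕₚ.+-comm (length qs) (length ps)) total) 2≤ps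

      -- They decide the zeros of `f`: on the tangent, where `h` is a coordinate, the cut is placed
      -- at `z` or at `y`.
      gz gy : Affine
      gz = falling h (h ⟪ z ⟫)
      gy = falling h (h ⟪ y ⟫)

      gz-eval : ∀ v → gz ⟪ v ⟫ ≈ h ⟪ z ⟫ - h ⟪ v ⟫
      gz-eval v = falling-⟨$⟩ h (h ⟪ z ⟫) (pt v)

      gy-eval : ∀ v → gy ⟪ v ⟫ ≈ h ⟪ y ⟫ - h ⟪ v ⟫
      gy-eval v = falling-⟨$⟩ h (h ⟪ y ⟫) (pt v)

      gz-z : gz ⟪ z ⟫ ≈ 0#
      gz-z = trans (gz-eval z) (-‿inverseʳ _)

      gy-y : gy ⟪ y ⟫ ≈ 0#
      gy-y = trans (gy-eval y) (-‿inverseʳ _)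

      gz-ps : ∀ {v} → v ∈ ps → Pos (gz ⟪ v ⟫)
      gz-ps {v} v∈ = pos-resp (sym (gz-eval v)) (pos-+ (h-qs z∈) (h-ps v∈))

      gy-qs : ∀ {v} → v ∈ qs → Pos (- gy ⟪ v ⟫)
      gy-qs {v} v∈ = pos-resp (trans (sym (neg-swap (h ⟪ y ⟫) (h ⟪ v ⟫))) (-‿cong (sym (gy-eval v)))) (pos-+ (h-qs v∈) (h-ps y∈))

      same-level : ∀ {u v} → f ⟪ u ⟫ ≈ 0# → f ⟪ v ⟫ ≈ 0# → h ⟪ u ⟫ ≈ h ⟪ v ⟫ → u ≡ v
      same-level {u} {v} zu zv e = pt-injective (level-injective h (rising y∈ z∈) (f⇒orient u zu) (f⇒orient v zv) e)

      unique-zero : ∀ a {u v} → f ⟪ u ⟫ ≈ 0# → falling h a ⟪ u ⟫ ≈ 0# → f ⟪ v ⟫ ≈ 0# → falling h a ⟪ v ⟫ ≈ 0# → u ≡ v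
      unique-zero a {u} {v} zu gu zv gv = same-level zu zv (trans (sym (level u gu)) (level v gv))
        where
        level : ∀ w → falling h a ⟪ w ⟫ ≈ 0# → a ≈ h ⟪ w ⟫
        level w e = x-y≈0⇒x≈y (trans (sym (falling-⟨$⟩ h a (pt w))) e)

      strict-ps : ∀ {v} → v ∈ ps → v ≡ y ⊎ LexPos f gy v
      strict-ps {v} v∈ with f-ps v∈
      ... | inj₁ p = inj₂ (inj₁ p)
      ... | inj₂ (e , inj₁ p) = inj₂ (inj₂ (e , pos-resp (sym (gy-eval v)) p))
      ... | inj₂ (e , inj₂ e') = inj₁ (same-level e f-y (sym (x-y≈0⇒x≈y e')))

      strict-qs : ∀ {v} → v ∈ qs → v ≡ z ⊎ Lex.LexNeg f gz v
      strict-qs {v} v∈ with f-qs v∈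
      ... | inj₁ p = inj₂ (inj₁ p)
      ... | inj₂ (e , inj₁ p) = inj₂ (inj₂ (e , pos-resp (trans (sym (neg-swap _ _)) (-‿cong (sym (gz-eval v)))) p))
      ... | inj₂ (e , inj₂ e') = inj₁ (same-level e f-z (x-y≈0⇒x≈y e'))

      z∉ps : z ∉ ps
      z∉ps z∈ps = disjoint z∈ps z∈

      y∉qs : y ∉ qs
      y∉qs = disjoint y∈

      lex-ps+z : ∀ {v} → v ∈ z ∷ ps → Lex.LexNonNeg f gz v
      lex-ps+z (here ≡.refl) = inj₂ (f-z , inj₂ gz-z)
      lex-ps+z (there v∈) with f-ps v∈
      ... | inj₁ p = inj₁ p
      ... | inj₂ (e , _) = inj₂ (e , inj₁ (gz-ps v∈))

      ps+z⊆ : z ∷ ps ⊆ ps ++ qs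
      ps+z⊆ (here ≡.refl) = ⊆ʳ z∈
      ps+z⊆ (there v∈) = ⊆ˡ v∈

      qs+y⊆ : y ∷ qs ⊆ ps ++ qs
      qs+y⊆ (here ≡.refl) = ⊆ˡ y∈
      qs+y⊆ (there v∈) = ⊆ʳ v∈

      convex-ps+z : Convex (z ∷ ps)
      convex-ps+z = convex-part f gz convex ps+z⊆ lex-ps+z λ v∈ → [ inj₁ ∘ there , other ]′ (∈-++⁻ ps v∈)
        where
        other : ∀ {v} → v ∈ qs → v ∈ z ∷ ps ⊎ Lex.LexNeg f gz v
        other v∈ with strict-qs v∈
        ... | inj₁ ≡.refl = inj₁ (here ≡.refl)
        ... | inj₂ below = inj₂ below

      convex-qs+y : Convex (y ∷ qs)
      convex-qs+y = convex-part (negate f) (negate gy) convex qs+y⊆ lex λ v∈ → [ other , inj₁ ∘ there ]′ (∈-++⁻ ps v∈)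
        where
        lex : ∀ {v} → v ∈ y ∷ qs → Lex.LexNonNeg (negate f) (negate gy) v
        lex (here ≡.refl) = inj₂ (negate-zero f y f-y , inj₂ (negate-zero gy y gy-y))
        lex {v} (there v∈) with f-qs v∈
        ... | inj₁ p = inj₁ (negate-pos f v p)
        ... | inj₂ (e , _) = inj₂ (negate-zero f v e , inj₁ (negate-pos gy v (gy-qs v∈)))
        other : ∀ {v} → v ∈ ps → v ∈ y ∷ qs ⊎ Lex.LexNeg (negate f) (negate gy) v
        other {v} v∈ with strict-ps v∈
        ... | inj₁ ≡.refl = inj₁ (here ≡.refl)
        ... | inj₂ (inj₁ p) = inj₂ (inj₁ (negate-neg f v p))
        ... | inj₂ (inj₂ (e , p)) = inj₂ (inj₂ (negate-zero f v e , negate-neg gy v p))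

      ¬col-ps+z : ¬ Col (z ∷ ps)
      ¬col-ps+z col = ¬on-ps λ {v} v∈ → orient⇒f v (col (there y∈) (here ≡.refl) (there v∈))

      ¬col-qs+y : ¬ Col (y ∷ qs)
      ¬col-qs+y col = ¬on-qs λ {v} v∈ → orient⇒f v (col (here ≡.refl) (there z∈) (there v∈))

      draw-ps+z : Drawing (z ∷ ps) (suc (suc m))
      draw-ps+z = IH (z ∷ ps) small-ps (unique-∷ z∉ps unique-ps) convex-ps+z ¬col-ps+z m
        λ c → ℕₚ.≤-trans (enough-ps c) (ℕₚ.m≤n+m _ _)

      draw-qs+y : ∀ r → (∀ c → suc r ℕ.≤ count c qs) → Drawing (y ∷ qs) (suc (suc r))
      draw-qs+y r enough = IH (y ∷ qs) small-qs (unique-∷ y∉qs unique-qs) convex-qs+y ¬col-qs+y r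
        λ c → ℕₚ.≤-trans (enough c) (ℕₚ.m≤n+m _ _)

      join-at-z : ∀ {k l} → Drawing (z ∷ ps) k → Drawing qs l → Drawing (ps ++ qs) (k ℕ.+ l)
      join-at-z = join f gz ps+z⊆ ⊆ʳ lex-ps+z lex-qs (λ _ _ → unique-zero (h ⟪ z ⟫))
        where
        lex-qs : ∀ {v} → v ∈ qs → Lex.LexNonPos f gz v
        lex-qs {v} v∈ with f-qs v∈
        ... | inj₁ p = inj₁ p
        ... | inj₂ (e , p) = inj₂ (e , nonNeg-resp (trans (sym (neg-swap _ _)) (-‿cong (sym (gz-eval v)))) p)

      join-at-y : ∀ {k l} → Drawing ps k → Drawing (y ∷ qs) l → Drawing (ps ++ qs) (k ℕ.+ l)
      join-at-y = join f gy ⊆ˡ qs+y⊆ lex-ps lex-qs+y (λ _ _ → unique-zero (h ⟪ y ⟫))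
        where
        lex-ps : ∀ {v} → v ∈ ps → Lex.LexNonNeg f gy v
        lex-ps {v} v∈ with f-ps v∈
        ... | inj₁ p = inj₁ p
        ... | inj₂ (e , p) = inj₂ (e , nonNeg-resp (sym (gy-eval v)) p)
        lex-qs+y : ∀ {v} → v ∈ y ∷ qs → Lex.LexNonPos f gy v
        lex-qs+y (here ≡.refl) = inj₂ (f-y , inj₂ (-zero gy-y))
        lex-qs+y (there v∈) with f-qs v∈
        ... | inj₁ p = inj₁ p
        ... | inj₂ (e , _) = inj₂ (e , inj₁ (gy-qs v∈))

      -- Turned slightly around z, the tangent separates rest from y ∷ qs.
      module BothCollinear (col-ps : Col ps) (col-qs : Col qs) {rest : List V} (ps↭ : ps ↭ y ∷ rest) where

        -- A second vertex on the tangent would, together with `y`, place all of the collinear `ps`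
        -- there, against the choice of the tangent.
        on-ps⇒y : ∀ {v} → v ∈ ps → f ⟪ v ⟫ ≈ 0# → v ≡ y
        on-ps⇒y {v} v∈ e with v ≟V y
        ... | yes v≡y = v≡y
        ... | no v≢y = ⊥-elim (¬on-ps λ {w} w∈ → orient⇒f w
                (collinear-line {pt y} {pt v} (pt-distinct (v≢y ∘ ≡.sym)) (orient-pqp (pt y) (pt v))
                  (trans (orient-swap₂₃ (pt y) (pt z) (pt v)) (-zero (f⇒orient v e))) (col-ps y∈ v∈ w∈)))

        on-qs⇒z : ∀ {v} → v ∈ qs → f ⟪ v ⟫ ≈ 0# → v ≡ z
        on-qs⇒z {v} v∈ e with v ≟V z
        ... | yes v≡z = v≡z
        ... | no v≢z = ⊥-elim (¬on-qs λ {w} w∈ → orient⇒f w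
                (collinear-line {pt z} {pt v} (pt-distinct (v≢z ∘ ≡.sym))
                  (trans (orient-cycle (pt y) (pt z) (pt v)) (f⇒orient v e)) (orient-pqp (pt z) (pt v)) (col-qs z∈ v∈ w∈)))

        rest⊆ : rest ⊆ ps
        rest⊆ v∈ = ∈-resp-↭ (↭-sym ps↭) (there v∈)

        unique-y∷rest : Unique (y ∷ rest)
        unique-y∷rest = unique-resp-↭ ps↭ unique-ps

        rest≢y : ∀ {v} → v ∈ rest → v ≢ y
        rest≢y v∈ v≡y with unique-y∷rest
        ... | y∉ ∷ _ = All.lookup y∉ v∈ (≡.sym v≡y)

        f-rest : ∀ {v} → v ∈ rest → Pos (f ⟪ v ⟫)
        f-rest v∈ with f-ps (rest⊆ v∈)
        ... | inj₁ p = p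
        ... | inj₂ (e , _) = ⊥-elim (rest≢y v∈ (on-ps⇒y (rest⊆ v∈) e))

        f-qs⁻ : ∀ {v} → v ∈ qs → v ≡ z ⊎ Pos (- f ⟪ v ⟫)
        f-qs⁻ v∈ with f-qs v∈
        ... | inj₁ p = inj₂ p
        ... | inj₂ (e , _) = inj₁ (on-qs⇒z v∈ e)

        lex-rest+z : ∀ {v} → v ∈ z ∷ rest → Lex.LexNonNeg f (negate gz) v
        lex-rest+z (here ≡.refl) = inj₂ (f-z , inj₂ (negate-zero gz z gz-z))
        lex-rest+z (there v∈) = inj₁ (f-rest v∈)

        rest+z⊆ : z ∷ rest ⊆ ps ++ qs
        rest+z⊆ (here ≡.refl) = ⊆ʳ z∈
        rest+z⊆ (there v∈) = ⊆ˡ (rest⊆ v∈)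

        convex-rest+z : Convex (z ∷ rest)
        convex-rest+z = convex-part f (negate gz) convex rest+z⊆ lex-rest+z
          λ v∈ → [ (λ v∈ → other (∈-resp-↭ ps↭ v∈)) , other' ]′ (∈-++⁻ ps v∈)
          where
          other : ∀ {v} → v ∈ y ∷ rest → v ∈ z ∷ rest ⊎ Lex.LexNeg f (negate gz) v
          other (here ≡.refl) = inj₂ (inj₂ (f-y , negate-neg gz y (gz-ps y∈)))
          other (there v∈) = inj₁ (there v∈)
          other' : ∀ {v} → v ∈ qs → v ∈ z ∷ rest ⊎ Lex.LexNeg f (negate gz) v
          other' v∈ with f-qs⁻ v∈
          ... | inj₁ ≡.refl = inj₁ (here ≡.refl)
          ... | inj₂ p = inj₂ (inj₁ p)

        join-across : ∀ {k l} → Drawing (z ∷ rest) k → Drawing (y ∷ qs) l → Drawing (ps ++ qs) (k ℕ.+ l)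
        join-across = join f (negate gz) rest+z⊆ qs+y⊆ lex-rest+z lex-qs+y
          λ {u} {v} _ _ zu gu zv gv → unique-zero (h ⟪ z ⟫) zu (back u gu) zv (back v gv)
          where
          back : ∀ v → negate gz ⟪ v ⟫ ≈ 0# → gz ⟪ v ⟫ ≈ 0#
          back v e = trans (sym (-‿involutive _)) (-zero (trans (sym (negate-⟨$⟩ gz (pt v))) e))
          lex-qs+y : ∀ {v} → v ∈ y ∷ qs → Lex.LexNonPos f (negate gz) v
          lex-qs+y (here ≡.refl) = inj₂ (f-y , inj₁ (negate-neg gz y (gz-ps y∈)))
          lex-qs+y (there v∈) with f-qs⁻ v∈
          ... | inj₁ ≡.refl = inj₂ (f-z , inj₂ (-zero (negate-zero gz z gz-z)))
          ... | inj₂ p = inj₁ p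

        -- `a` and `b` span the line of `ps`, which contains `y`. With `z` on it as well it would be
        -- the tangent, which meets `ps` only in `y`.
        ¬col-rest+z : ∀ {a b} → a ∈ rest → b ∈ rest → a ≢ b → ¬ Col (z ∷ rest)
        ¬col-rest+z {a} {b} a∈ b∈ a≢b col = rest≢y a∈ (on-ps⇒y (rest⊆ a∈) (orient⇒f a
          (collinear-line {pt a} {pt b} (pt-distinct a≢b) (col-ps (rest⊆ a∈) (rest⊆ b∈) y∈)
            (col (there a∈) (there b∈) (here ≡.refl)) (orient-pqp (pt a) (pt b)))))

        -- Losing `y` lowers each count by at most one, so `m` vertices of either colour remain; `m`
        -- must be positive for the induction hypothesis.
        draw-rest+z : ∀ m' → m ≡ suc m' → Drawing (z ∷ rest) (suc m)
        draw-rest+z m' ≡.refl = IH (z ∷ rest) small (unique-∷ (z∉ps ∘ rest⊆) unique-rest) convex-rest+z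
          (let _ , _ , a∈ , b∈ , a≢b = distinct-members unique-rest 2≤rest in ¬col-rest+z a∈ b∈ a≢b) m'
          λ c → ℕₚ.≤-trans (enough-rest c) (ℕₚ.m≤n+m _ _)
          where
          unique-rest : Unique rest
          unique-rest with unique-y∷rest
          ... | _ ∷ u = u
          enough-rest : ∀ c → suc m' ℕ.≤ count c rest
          enough-rest c = ℕₚ.≤-pred (ℕₚ.≤-trans (ℕₚ.≤-reflexive (≡.trans (≡.sym (balanced c)) (count-↭ c ps↭)))
            (ℕₚ.+-monoˡ-≤ (count c rest) (indicator≤1 c (colour y))))
          2≤rest : 2 ℕ.≤ length rest
          2≤rest = ≡.subst (2 ℕ.≤_) (count-sum true rest) (ℕₚ.+-mono-≤
            (ℕₚ.≤-trans (s≤s z≤n) (enough-rest true)) (ℕₚ.≤-trans (s≤s z≤n) (enough-rest false)))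
          small : length (z ∷ rest) ℕ.< length (ps ++ qs)
          small = ≡.subst (ℕ._< length (ps ++ qs)) (↭-length ps↭) (ℕₚ.<-trans (ℕₚ.n<1+n _) small-ps)

      -- A non-collinear part can be drawn by itself, and the tangent end goes to the other part;
      -- this leaves one edge to spare. With both parts collinear the count is exact.
      assemble : ∀ r → (∀ c → suc r ℕ.≤ count c qs) → Dec (Col ps) → Dec (Col qs) → ∀ m' → m ≡ m' →
        Drawing (ps ++ qs) (suc m ℕ.+ suc (suc r))
      assemble r enough _ (no ¬col-qs) _ _ = weaken id (ℕₚ.n≤1+n _)
        (join-at-z draw-ps+z (IH qs (ℕₚ.<-trans (ℕₚ.n<1+n _) small-qs) unique-qs convex-qs ¬col-qs r enough))
      assemble r enough (no ¬col-ps) (yes _) _ _ = weaken id (ℕₚ.n≤1+n _)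
        (join-at-y (IH ps (ℕₚ.<-trans (ℕₚ.n<1+n _) small-ps) unique-ps convex-ps ¬col-ps m enough-ps) (draw-qs+y r enough))
      -- Here `ps` has one vertex of each colour, and its single edge already gives the `suc m`
      -- edges wanted from it.
      assemble r enough (yes col-ps) (yes col-qs) zero ≡.refl =
        join-at-y (bichromatic⇒edge true convex-ps (enough-ps true) (enough-ps false)) (draw-qs+y r enough)
      assemble r enough (yes col-ps) (yes col-qs) (suc m') e = join-across (draw-rest+z m' e) (draw-qs+y r enough)
        where open BothCollinear col-ps col-qs (proj₂ (extract y∈))

      minority : ∃ λ c → count c qs ≡ count true qs ℕ.⊓ count false qs
      minority = [ (λ e → true , ≡.sym e) , (λ e → false , ≡.sym e) ]′ (ℕₚ.⊓-sel (count true qs) (count false qs))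

      minority≤ : ∀ c → count true qs ℕ.⊓ count false qs ℕ.≤ count c qs
      minority≤ true = ℕₚ.m⊓n≤m _ _
      minority≤ false = ℕₚ.m⊓n≤n (count true qs) _

      split-large : ∀ k → (∀ c → suc k ℕ.≤ count c (ps ++ qs)) → Drawing (ps ++ qs) (suc (suc k))
      split-large k enough = go (count true qs ℕ.⊓ count false qs) ≡.refl
        where
        bound : suc k ℕ.≤ suc m ℕ.+ (count true qs ℕ.⊓ count false qs)
        bound = let c , e = minority in
          ≡.subst (suc k ℕ.≤_) (≡.trans (count-++ c ps qs) (≡.cong₂ ℕ._+_ (balanced c) e)) (enough c)
        go : ∀ r → count true qs ℕ.⊓ count false qs ≡ r → Drawing (ps ++ qs) (suc (suc k))
        -- A colour is missing from `qs`, so all its occurrences are in `ps`, and `ps` with `z`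
        -- suffices.
        go zero e = weaken ps+z⊆ (s≤s (≡.subst (suc k ℕ.≤_) (≡.trans (≡.cong (suc m ℕ.+_) e) (ℕₚ.+-identityʳ _)) bound)) draw-ps+z
        go (suc r) e = weaken id
          (ℕₚ.≤-trans (s≤s (≡.subst (λ r → suc k ℕ.≤ suc m ℕ.+ r) e bound)) (ℕₚ.≤-reflexive (≡.sym (ℕₚ.+-suc (suc m) (suc r)))))
          (assemble r (λ c → ≡.subst (ℕ._≤ count c qs) e (minority≤ c)) (col? ps) (col? qs) m ≡.refl)

    split-drawing : 2 ℕ.≤ length qs → ∀ k → (∀ c → suc k ℕ.≤ count c (ps ++ qs)) → Drawing (ps ++ qs) (suc (suc k))
    split-drawing 2≤qs =
      let _ , _ , p∈ , p'∈ , p≢p' = distinct-members unique-ps 2≤ps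
          _ , _ , q∈ , q'∈ , q≢q' = distinct-members unique-qs 2≤qs
          _ , t , ¬on-ps , ¬on-qs = goodTangent ¬col p∈ p'∈ p≢p' q∈ q'∈ q≢q'
      in Along.split-large 2≤qs t ¬on-ps ¬on-qs

  -- A single vertex in `qs` is treated apart, as `ps` with `z` would be the whole set. Then either
  -- `ps` is collinear and `z` is the apex of a fan, or `ps` alone suffices: `z` does not increase
  -- the count of the other colour.
  splitDrawing : ∀ {ps qs} → Unique ps → Unique qs → Convex (ps ++ qs) → ¬ Col (ps ++ qs) →
    (h : Affine) → (∀ {v} → v ∈ ps → Pos (- h ⟪ v ⟫)) → (∀ {v} → v ∈ qs → Pos (h ⟪ v ⟫)) →
    ∀ m → (∀ c → count c ps ≡ suc m) → (∀ vs → length vs ℕ.< length (ps ++ qs) → Claim vs) →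
    1 ℕ.≤ length qs → ∀ k → (∀ c → suc k ℕ.≤ count c (ps ++ qs)) → Drawing (ps ++ qs) (suc (suc k))
  splitDrawing {ps} {z ∷ []} up uq convex ¬col h h-ps h-qs m balanced IH _ k enough = go (col? ps)
    where
    open Split up uq convex ¬col h h-ps h-qs m balanced IH using (⊆ˡ; convex-ps; enough-ps)
    perm : ps ++ z ∷ [] ↭ z ∷ ps
    perm = ++-comm ps (z ∷ [])
    forth : ps ++ z ∷ [] ⊆ z ∷ ps
    forth = ∈-resp-↭ perm
    back : z ∷ ps ⊆ ps ++ z ∷ []
    back = ∈-resp-↭ (↭-sym perm)
    z∉ps : z ∉ ps
    z∉ps z∈ps = pos-neg (h-qs (here ≡.refl)) (h-ps z∈ps)
    go : Dec (Col ps) → Drawing (ps ++ z ∷ []) (suc (suc k))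
    go (yes col) = weaken back ℕₚ.≤-refl
      (Fan.fan-drawing z∉ps up (convex-resp forth back convex) col (λ col' → ¬col (col-⊆ forth col')) k
        λ c → ≡.subst (suc k ℕ.≤_) (count-↭ c perm) (enough c))
    go (no ¬col-ps) = weaken ⊆ˡ (s≤s k≤m)
      (IH ps (ℕₚ.≤-reflexive (≡.sym (↭-length perm))) up convex-ps ¬col-ps m enough-ps)
      where
      d = not (colour z)
      k≤m : suc k ℕ.≤ suc m
      k≤m = ≡.subst (suc k ℕ.≤_) (≡.trans (count-↭ d perm)
        (≡.cong₂ ℕ._+_ (indicator-other (colour z)) (balanced d))) (enough d)
  splitDrawing {ps} {_ ∷ _ ∷ _} up uq convex ¬col h h-ps h-qs m balanced IH _ =
    Split.split-drawing up uq convex ¬col h h-ps h-qs m balanced IH (s≤s (s≤s z≤n))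

  -- Sweeping around a corner

  unique-++⁻ : ∀ (ps : List V) {qs} → Unique (ps ++ qs) →
    Unique ps × Unique qs × (∀ {u v} → u ∈ ps → v ∈ qs → u ≢ v)
  unique-++⁻ [] unique = [] , unique , λ ()
  unique-++⁻ (p ∷ ps) (p∉ ∷ unique) with unique-++⁻ ps unique
  ... | up , uq , distinct = All.tabulate (λ v∈ → All.lookup p∉ (∈-++⁺ˡ v∈)) ∷ up , uq ,
    λ { (here ≡.refl) v∈ → All.lookup p∉ (∈-++⁺ʳ ps v∈) ; (there u∈) v∈ → distinct u∈ v∈ }

  nonempty : ∀ {v : V} {vs} → v ∈ vs → 1 ℕ.≤ length vs
  nonempty (here _) = s≤s z≤n
  nonempty (there _) = s≤s z≤n

  balanced-count : ∀ c {ps : List V} {v} → v ∈ ps → count c ps ≡ count (not c) ps → ∃ λ m → ∀ d → count d ps ≡ suc m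
  balanced-count c {ps} {v} v∈ e = positive (count true ps) ≡.refl
    where
    true≡false : ∀ c → count c ps ≡ count (not c) ps → count false ps ≡ count true ps
    true≡false true e = ≡.sym e
    true≡false false e = e
    positive : ∀ k → count true ps ≡ k → ∃ λ m → ∀ d → count d ps ≡ suc m
    positive zero e' = ⊥-elim (ℕₚ.<⇒≱ (nonempty v∈) (ℕₚ.≤-reflexive (≡.trans (≡.sym (count-sum true ps))
      (≡.cong₂ ℕ._+_ e' (≡.trans (true≡false c e) e')))))
    positive (suc m) e' = m , λ { true → e' ; false → ≡.trans (true≡false c e) e' }

  -- The line `h = 0` touches the set in `p` alone, so that all directions from `p` lie in an open
  -- half-plane and can be ordered by angle.
  module Sweep {p q : V} {rs : List V} (unique : Unique (p ∷ q ∷ rs)) (convex : Convex (p ∷ q ∷ rs))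
    (¬col : ¬ Col (p ∷ q ∷ rs)) (IH : ∀ vs → length vs ℕ.< length (p ∷ q ∷ rs) → Claim vs)
    (k : ℕ) (enough : ∀ c → suc k ℕ.≤ count c (p ∷ q ∷ rs))
    (h : Affine) (h-p : h ⟪ p ⟫ ≈ 0#) (h-rest : ∀ {v} → v ∈ q ∷ rs → Pos (h ⟪ v ⟫)) where

    us : List V
    us = p ∷ q ∷ rs

    linear-h : ∀ v → linear h (vec (pt p) (pt v)) ≈ h ⟪ v ⟫
    linear-h v = trans (linear-vec h (pt p) (pt v)) (trans (+-congˡ (-zero h-p)) (+-identityʳ _))

    linear-pos : ∀ {v} → v ∈ q ∷ rs → Pos (linear h (vec (pt p) (pt v)))
    linear-pos {v} v∈ = pos-resp (sym (linear-h v)) (h-rest v∈)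

    -- Counterclockwise around p, on each ray from the outside to p.
    open Angular true (λ v → - linear h v)

    infix 4 _≼_
    _≼_ : V → V → Set (ℓ₁ ⊔ ℓ₂)
    u ≼ v = vec (pt p) (pt u) ⊑ vec (pt p) (pt v)

    p∉ : p ∉ q ∷ rs
    p∉ p∈ = All.lookup (AllPairs.head unique) p∈ ≡.refl

    unique-rest : Unique (q ∷ rs)
    unique-rest = AllPairs.tail unique

    separated : ∀ f g {ps qs} → us ↭ ps ++ qs →
      (∀ {v} → v ∈ ps → Lex.LexNonNeg f g v) → (∀ {v} → v ∈ qs → Lex.LexNeg f g v) →
      ∀ d → count d ps ≡ count (not d) ps → ∀ {u v} → u ∈ ps → v ∈ qs → Drawing us (suc (suc k))
    separated f g {ps} {qs} perm lex-ps lex-qs d balanced u∈ v∈ = weaken back ℕₚ.≤-refl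
      (splitDrawing unique-ps unique-qs (convex-resp forth back convex) (λ col → ¬col (col-⊆ forth col))
        (negate h') (λ {v} v∈ → negate-neg h' v (proj₁ (h'-sign (back (∈-++⁺ˡ v∈))) (lex-ps v∈)))
        (λ {v} v∈ → negate-pos h' v (proj₂ (h'-sign (back (∈-++⁺ʳ ps v∈))) (lex-qs v∈)))
        (proj₁ m) (proj₂ m) (λ vs lt → IH vs (≡.subst (length vs ℕ.<_) (≡.sym (↭-length perm)) lt))
        (nonempty v∈) k (λ c → ≡.subst (suc k ℕ.≤_) (count-↭ c perm) (enough c)))
      where
      forth : us ⊆ ps ++ qs
      forth = ∈-resp-↭ perm
      back : ps ++ qs ⊆ us
      back = ∈-resp-↭ (↭-sym perm)
      parts = unique-++⁻ ps (unique-resp-↭ perm unique)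
      unique-ps = proj₁ parts
      unique-qs = proj₁ (proj₂ parts)
      h' = proj₁ (Lex.separate f g us)
      h'-sign = proj₂ (Lex.separate f g us)
      m = balanced-count d u∈ balanced

    p-below : ∀ {a} → Pos a → Pos (- offset h a ⟪ p ⟫)
    p-below {a} = pos-resp (sym (trans (-‿cong (trans (offset-⟨$⟩ h a (pt p)) (+-congʳ h-p)))
      (trans (neg-swap 0# a) (trans (+-congˡ (-zero refl)) (+-identityʳ a)))))

    same-point : ∀ {t u v} → t ∈ q ∷ rs → orient (pt p) (pt t) (pt u) ≈ 0# → orient (pt p) (pt t) (pt v) ≈ 0# →
      h ⟪ u ⟫ - h ⟪ v ⟫ ≈ 0# → u ≡ v
    same-point t∈ ou ov e = pt-injective (level-injective h (linear-pos t∈) ou ov (x-y≈0⇒x≈y e))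

    open TotalPreorder (λ v → Pos (linear h (vec (pt p) (pt v)))) _≼_
      (λ {u} {v} _ _ → ⊑-total (vec (pt p) (pt u)) (vec (pt p) (pt v)))
      (λ a b c → ⊑-trans h a b c) using (BalancedPrefix; balancedPrefix)

    ray-eval : ∀ t v → signedThrough true (pt p) (pt t) ⟪ v ⟫ ≈ - orient (pt p) (pt t) (pt v)
    ray-eval t v = signedThrough-⟨$⟩ true (pt p) (pt t) (pt v)

    -- The cut follows the ray from `p` through the last vertex `t`, turned slightly about a point
    -- just before `t`. It leaves `p` and the inner vertices of that ray on the side of the suffix,
    -- which is why rays are read from the outside and why the second part is never empty.
    angularSplit : ∀ {d} → BalancedPrefix colour d (q ∷ rs) → Drawing us (suc (suc k))
    angularSplit {d} b = separated f (offset h (h ⟪ t ⟫)) perm' lex-prefix lex-suffix d balanced last∈ (here ≡.refl)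
      where
      open BalancedPrefix b renaming (last to t)
      f = signedThrough true (pt p) (pt t)
      perm' : us ↭ prefix ++ p ∷ suffix
      perm' = ↭-trans (prep p perm) (↭-sym (shift p prefix suffix))
      in-rest : ∀ {v} → v ∈ prefix ++ suffix → v ∈ q ∷ rs
      in-rest = ∈-resp-↭ (↭-sym perm)
      t∈ : t ∈ q ∷ rs
      t∈ = in-rest (∈-++⁺ˡ last∈)
      distinct : ∀ {v} → v ∈ suffix → t ≢ v
      distinct = proj₂ (proj₂ (unique-++⁻ prefix (unique-resp-↭ perm unique-rest))) last∈
      lex-prefix : ∀ {v} → v ∈ prefix → Lex.LexNonNeg f (offset h (h ⟪ t ⟫)) v
      lex-prefix {v} v∈ = go (≼last v∈)
        where
        f≈ : f ⟪ v ⟫ ≈ cross (vec (pt p) (pt v)) (vec (pt p) (pt t))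
        f≈ = trans (ray-eval t v) (sym (cross-antisym true (vec (pt p) (pt t)) (vec (pt p) (pt v))))
        go : v ≼ t → Lex.LexNonNeg f (offset h (h ⟪ t ⟫)) v
        go (inj₁ turn) = inj₁ (pos-resp (sym f≈) turn)
        go (inj₂ (e , tie)) = inj₂ (trans f≈ e , nonNeg-resp
          (trans (+-comm _ _) (trans (+-congʳ (-‿involutive _)) (trans (+-cong (linear-h v) (-‿cong (linear-h t))) (sym (offset-⟨$⟩ h (h ⟪ t ⟫) (pt v)))))) tie)
      lex-suffix : ∀ {v} → v ∈ p ∷ suffix → Lex.LexNeg f (offset h (h ⟪ t ⟫)) v
      lex-suffix (here ≡.refl) = inj₂ (trans (ray-eval t p) (-zero (orient-pqp (pt p) (pt t))) , p-below (h-rest t∈))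
      lex-suffix {v} (there v∈) = go (last≼ v∈)
        where
        tie-eval : - linear h (vec (pt p) (pt v)) - - linear h (vec (pt p) (pt t)) ≈ h ⟪ t ⟫ - h ⟪ v ⟫
        tie-eval = trans (+-comm _ _) (trans (+-congʳ (-‿involutive _)) (+-cong (linear-h t) (-‿cong (linear-h v))))
        go : t ≼ v → Lex.LexNeg f (offset h (h ⟪ t ⟫)) v
        go (inj₁ turn) = inj₁ (pos-resp (trans (sym (-‿involutive _)) (-‿cong (sym (ray-eval t v)))) turn)
        go (inj₂ (e , inj₁ tie)) = inj₂ (trans (ray-eval t v) (-zero e) ,
          pos-resp (trans tie-eval (trans (sym (neg-swap _ _)) (-‿cong (sym (offset-⟨$⟩ h (h ⟪ t ⟫) (pt v)))))) tie)
        go (inj₂ (e , inj₂ tie)) = ⊥-elim (distinct v∈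
          (same-point t∈ (orient-pqq (pt p) (pt t)) e (trans (sym tie-eval) tie)))

    singleton : ∀ v d → colour v ≡ d → count (not d) (v ∷ []) ℕ.< count d (v ∷ [])
    singleton v d ≡.refl = ≡.subst₂ (λ i j → i ℕ.+ 0 ℕ.< j ℕ.+ 0) (≡.sym (indicator-other d)) (≡.sym (indicator-same d)) (s≤s z≤n)

    -- Nothing precedes `q`, so the line `pq` has all vertices on one side: `p ∷ q ∷ ray` is a side
    -- of the hull with ends `p` and `q`, and a piece at either end of it can be cut off by a line.
    module FirstRay (q≼ : ∀ {v} → v ∈ rs → q ≼ v) {ray others : List V} (rs↭ : rs ↭ ray ++ others)
      (on-ray : All (λ v → orient (pt p) (pt q) (pt v) ≈ 0#) ray)
      (off-ray : All (λ v → ¬ orient (pt p) (pt q) (pt v) ≈ 0#) others) where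

      f : Affine
      f = signedThrough true (pt p) (pt q)

      ray⊆ : ray ⊆ rs
      ray⊆ v∈ = ∈-resp-↭ (↭-sym rs↭) (∈-++⁺ˡ v∈)

      others⊆ : others ⊆ rs
      others⊆ v∈ = ∈-resp-↭ (↭-sym rs↭) (∈-++⁺ʳ ray v∈)

      on-line : ∀ {v} → v ∈ p ∷ q ∷ ray → orient (pt p) (pt q) (pt v) ≈ 0#
      on-line (here ≡.refl) = orient-pqp (pt p) (pt q)
      on-line (there (here ≡.refl)) = orient-pqq (pt p) (pt q)
      on-line (there (there v∈)) = All.lookup on-ray v∈

      f-line : ∀ {v} → v ∈ p ∷ q ∷ ray → f ⟪ v ⟫ ≈ 0#
      f-line {v} v∈ = trans (ray-eval q v) (-zero (on-line v∈))

      f-others : ∀ {v} → v ∈ others → Pos (- f ⟪ v ⟫)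
      f-others {v} v∈ = go (q≼ (others⊆ v∈))
        where
        go : q ≼ v → Pos (- f ⟪ v ⟫)
        go (inj₁ turn) = pos-resp (trans (sym (-‿involutive _)) (-‿cong (sym (ray-eval q v)))) turn
        go (inj₂ (e , _)) = ⊥-elim (All.lookup off-ray v∈ e)

      farthest : ∀ {v} → v ∈ ray → NonNeg (h ⟪ q ⟫ - h ⟪ v ⟫)
      farthest {v} v∈ = go (q≼ (ray⊆ v∈))
        where
        go : q ≼ v → NonNeg (h ⟪ q ⟫ - h ⟪ v ⟫)
        go (inj₁ turn) = ⊥-elim (pos⇒≉0 turn (All.lookup on-ray v∈))
        go (inj₂ (_ , tie)) = nonNeg-resp
          (trans (+-comm _ _) (trans (+-congʳ (-‿involutive _)) (+-cong (linear-h q) (-‿cong (linear-h v))))) tie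

      unique-line : Unique ((p ∷ q ∷ ray) ++ others)
      unique-line = unique-resp-↭ (prep p (prep q rs↭)) unique

      strict : ∀ {u v} → u ∈ p ∷ q ∷ ray → v ∈ p ∷ q ∷ ray → u ≢ v → NonNeg (h ⟪ u ⟫ - h ⟪ v ⟫) → Pos (h ⟪ u ⟫ - h ⟪ v ⟫)
      strict u∈ v∈ u≢v (inj₁ turn) = turn
      strict u∈ v∈ u≢v (inj₂ e) = ⊥-elim (u≢v (same-point (here ≡.refl) (on-line u∈) (on-line v∈) e))

      module Inwards = TotalPreorder {A = V} (λ v → v ≡ v) (λ u v → NonNeg (h ⟪ u ⟫ - h ⟪ v ⟫))
        (λ {u} {v} _ _ → nonNeg-total (h ⟪ u ⟫) (h ⟪ v ⟫)) (λ _ _ _ → nonNeg-trans)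
      module Outwards = TotalPreorder {A = V} (λ v → v ≡ v) (λ u v → NonNeg (h ⟪ v ⟫ - h ⟪ u ⟫))
        (λ {u} {v} _ _ → nonNeg-total (h ⟪ v ⟫) (h ⟪ u ⟫)) (λ _ _ _ a b → nonNeg-trans b a)

      inwardSplit : ∀ {d} → Inwards.BalancedPrefix colour d (q ∷ ray) → Drawing us (suc (suc k))
      inwardSplit {d} b = separated f (offset h (h ⟪ t ⟫)) perm' lex-prefix lex-suffix d balanced last∈ (here ≡.refl)
        where
        open Inwards.BalancedPrefix b renaming (last to t)
        perm' : us ↭ prefix ++ p ∷ suffix ++ others
        perm' = ↭-trans (prep p (↭-trans (prep q rs↭) (↭-trans (++⁺ʳ others perm) (++-assoc prefix suffix others))))
          (↭-sym (shift p prefix (suffix ++ others)))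
        in-line : ∀ {v} → v ∈ prefix ++ suffix → v ∈ p ∷ q ∷ ray
        in-line v∈ = there (∈-resp-↭ (↭-sym perm) v∈)
        unique-ray : Unique (prefix ++ suffix)
        unique-ray = unique-resp-↭ perm (proj₁ (unique-++⁻ (q ∷ ray) (unique-resp-↭ (prep q rs↭) unique-rest)))
        lex-prefix : ∀ {v} → v ∈ prefix → Lex.LexNonNeg f (offset h (h ⟪ t ⟫)) v
        lex-prefix {v} v∈ = inj₂ (f-line (in-line (∈-++⁺ˡ v∈)) , nonNeg-resp (sym (offset-⟨$⟩ h (h ⟪ t ⟫) (pt v))) (≼last v∈))
        t>0 : Pos (h ⟪ t ⟫)
        t>0 = h-rest (∈-resp-↭ (↭-sym (prep q rs↭)) (∈-++⁺ˡ (∈-resp-↭ (↭-sym perm) (∈-++⁺ˡ last∈))))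
        below : ∀ {v} → v ∈ suffix → Pos (- offset h (h ⟪ t ⟫) ⟪ v ⟫)
        below {v} v∈ = pos-resp (trans (sym (neg-swap _ _)) (-‿cong (sym (offset-⟨$⟩ h (h ⟪ t ⟫) (pt v)))))
          (strict (in-line (∈-++⁺ˡ last∈)) (in-line (∈-++⁺ʳ prefix v∈))
            (proj₂ (proj₂ (unique-++⁻ prefix unique-ray)) last∈ v∈) (last≼ v∈))
        lex-suffix : ∀ {v} → v ∈ p ∷ suffix ++ others → Lex.LexNeg f (offset h (h ⟪ t ⟫)) v
        lex-suffix (here ≡.refl) = inj₂ (f-line (here ≡.refl) , p-below t>0)
        lex-suffix {v} (there v∈) = [ (λ v∈ → inj₂ (f-line (in-line (∈-++⁺ʳ prefix v∈)) , below v∈))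
                                    , (λ v∈ → inj₁ (f-others v∈)) ]′ (∈-++⁻ suffix v∈)

      -- Otherwise the whole set would lie on `pq`. A prefix read from `p` may use up the side, and
      -- the second part must not be empty.
      others-member : ∃ λ v → v ∈ others
      others-member = go others λ v∈ → ∈-resp-↭ rs↭ v∈
        where
        go : ∀ os → (∀ {v} → v ∈ rs → v ∈ ray ++ os) → ∃ λ v → v ∈ os
        go (o ∷ _) _ = o , here ≡.refl
        go [] rs⊆ = ⊥-elim (¬col (collinear-through {a = p} {b = q} p≢q (λ v∈ → on-line (line v∈))))
          where
          p≢q : p ≢ q
          p≢q ≡.refl = p∉ (here ≡.refl)
          line : ∀ {v} → v ∈ us → v ∈ p ∷ q ∷ ray
          line (here e) = here e
          line (there (here e)) = there (here e)
          line {v} (there (there v∈)) with ∈-++⁻ ray {[]} (rs⊆ v∈)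
          ... | inj₁ v∈ray = there (there v∈ray)

      outwardSplit : ∀ {d} → Outwards.BalancedPrefix colour d (p ∷ q ∷ ray) → Drawing us (suc (suc k))
      outwardSplit {d} b = separated f (falling h (h ⟪ t ⟫)) perm' lex-prefix lex-suffix d balanced last∈
        (∈-++⁺ʳ suffix (proj₂ others-member))
        where
        open Outwards.BalancedPrefix b renaming (last to t)
        perm' : us ↭ prefix ++ suffix ++ others
        perm' = ↭-trans (prep p (prep q rs↭)) (↭-trans (++⁺ʳ others perm) (++-assoc prefix suffix others))
        in-line : ∀ {v} → v ∈ prefix ++ suffix → v ∈ p ∷ q ∷ ray
        in-line v∈ = ∈-resp-↭ (↭-sym perm) v∈
        unique-prefix : Unique (prefix ++ suffix)
        unique-prefix = unique-resp-↭ perm (proj₁ (unique-++⁻ (p ∷ q ∷ ray) unique-line))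
        lex-prefix : ∀ {v} → v ∈ prefix → Lex.LexNonNeg f (falling h (h ⟪ t ⟫)) v
        lex-prefix {v} v∈ = inj₂ (f-line (in-line (∈-++⁺ˡ v∈)) , nonNeg-resp (sym (falling-⟨$⟩ h _ (pt v))) (≼last v∈))
        beyond : ∀ {v} → v ∈ suffix → Pos (- falling h (h ⟪ t ⟫) ⟪ v ⟫)
        beyond {v} v∈ = pos-resp (trans (sym (neg-swap _ _)) (-‿cong (sym (falling-⟨$⟩ h _ (pt v)))))
          (strict (in-line (∈-++⁺ʳ prefix v∈)) (in-line (∈-++⁺ˡ last∈))
            (λ v≡t → proj₂ (proj₂ (unique-++⁻ prefix unique-prefix)) last∈ v∈ (≡.sym v≡t)) (last≼ v∈))
        lex-suffix : ∀ {v} → v ∈ suffix ++ others → Lex.LexNeg f (falling h (h ⟪ t ⟫)) v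
        lex-suffix {v} v∈ = [ (λ v∈ → inj₂ (f-line (in-line (∈-++⁺ʳ prefix v∈)) , beyond v∈))
                            , (λ v∈ → inj₁ (f-others v∈)) ]′ (∈-++⁻ suffix v∈)

      -- If no prefix of the side is balanced when it is read from its far end q, then the colour
      -- of q prevails on it, and a balanced prefix appears when it is read from p.
      raySplit : ∀ d → colour p ≡ d → colour q ≡ not d → Drawing us (suc (suc k))
      raySplit d p-colour q-colour with count (not d) (q ∷ ray) ℕ.≤? count (not (not d)) (q ∷ ray)
      ... | yes le = inwardSplit (Inwards.balancedPrefix colour (not d) (length ray) (q ∷ []) ray ℕₚ.≤-refl
              (≡.refl ∷ []) (All.universal (λ _ → ≡.refl) ray) (λ { (here ≡.refl) v∈ → farthest v∈ })
              (singleton q (not d) q-colour) le)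
      ... | no gt = outwardSplit (Outwards.balancedPrefix colour d (length (q ∷ ray)) (p ∷ []) (q ∷ ray) ℕₚ.≤-refl
              (≡.refl ∷ []) (All.universal (λ _ → ≡.refl) (q ∷ ray))
              (λ { (here ≡.refl) v∈ → inj₁ (pos-resp (sym (trans (+-congˡ (-zero h-p)) (+-identityʳ _)))
                     (h-rest (∈-resp-↭ (↭-sym (prep q rs↭)) (∈-++⁺ˡ v∈)))) })
              (singleton p d p-colour)
              -- The colour of `q` has a strict majority on the side without `p`; adding `p` to the
              -- other colour leaves at least equality.
              (≡.subst₂ ℕ._≤_
                (≡.cong (ℕ._+ count d (q ∷ ray)) (≡.sym (≡.trans (≡.cong (indicator d) p-colour) (indicator-same d))))
                (≡.cong (ℕ._+ count (not d) (q ∷ ray)) (≡.sym (≡.trans (≡.cong (indicator (not d)) p-colour) (indicator-other d))))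
                (≡.subst (λ e → suc (count e (q ∷ ray)) ℕ.≤ count (not d) (q ∷ ray)) (Bool.not-involutive d) (ℕₚ.≰⇒> gt))))

    -- The colour of `p` is in strict surplus, so its count without `p` is still no smaller than
    -- that of the other colour, which is unchanged.
    peel : ∀ d → colour p ≡ d → count (not d) us ℕ.< count d us → Drawing us (suc (suc k))
    peel d ≡.refl lt with col? (q ∷ rs)
    ... | yes col = Fan.fan-drawing p∉ unique-rest convex col ¬col k enough
    ... | no ¬col-rest = weaken there ℕₚ.≤-refl (IH (q ∷ rs) ℕₚ.≤-refl unique-rest convex-rest ¬col-rest k enough-rest)
      where
      convex-rest : Convex (q ∷ rs)
      -- The negative constant puts `p`, where `h` vanishes, on the excluded side.
      convex-rest = convex-part h (constant (- 1#)) convex there (λ v∈ → inj₁ (h-rest v∈)) λ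
        { (here ≡.refl) → inj₂ (inj₂ (h-p , pos-resp (sym (trans (-‿cong (constant-⟨$⟩ (- 1#) (pt p))) (-‿involutive 1#))) pos-1))
        ; (there v∈) → inj₁ v∈ }
      count-other : count (not d) us ≡ count (not d) (q ∷ rs)
      count-other = ≡.cong (ℕ._+ count (not d) (q ∷ rs)) (indicator-other d)
      count-same : count d us ≡ suc (count d (q ∷ rs))
      count-same = ≡.cong (ℕ._+ count d (q ∷ rs)) (indicator-same d)
      same : suc k ℕ.≤ count d (q ∷ rs)
      same = ℕₚ.≤-pred (≡.subst (suc (suc k) ℕ.≤_) count-same (ℕₚ.≤-trans (s≤s (enough (not d))) lt))
      other : suc k ℕ.≤ count (not d) (q ∷ rs)
      other = ≡.subst (suc k ℕ.≤_) count-other (enough (not d))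
      both : ∀ d → suc k ℕ.≤ count d (q ∷ rs) → suc k ℕ.≤ count (not d) (q ∷ rs) → ∀ e → suc k ℕ.≤ count e (q ∷ rs)
      both true s o true = s
      both true s o false = o
      both false s o true = o
      both false s o false = s
      enough-rest : ∀ e → suc k ℕ.≤ count e (q ∷ rs)
      enough-rest = both d same other

    draw : (∀ {v} → v ∈ rs → q ≼ v) → Drawing us (suc (suc k))
    draw q≼ with colour q Bool.≟ colour p
    ... | no differ = let _ , _ , rs↭ , on , off = separate-↭ (λ v → orient (pt p) (pt q) (pt v) ≈0?) rs in
            FirstRay.raySplit q≼ rs↭ on off (colour p) ≡.refl (Bool.¬-not differ)
    ... | yes same with count (colour p) us ℕ.≤? count (not (colour p)) us
    ...   | no gt = peel (colour p) ≡.refl (ℕₚ.≰⇒> gt)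
    -- The sweep starts from `q` alone, where the common colour leads, and ends with all vertices
    -- but `p`, where it does not; in between the counts are equal.
    ...   | yes le = angularSplit (balancedPrefix colour (colour p) (length rs) (q ∷ []) rs ℕₚ.≤-refl
              (linear-pos (here ≡.refl) ∷ []) (All.tabulate (λ v∈ → linear-pos (there v∈)))
              (λ { (here ≡.refl) v∈ → q≼ v∈ }) (singleton q (colour p) same)
              (ℕₚ.≤-trans (ℕₚ.m≤n+m _ (indicator (colour p) (colour p))) (ℕₚ.≤-trans le
                (ℕₚ.≤-reflexive (≡.cong (ℕ._+ count (not (colour p)) (q ∷ rs)) (indicator-other (colour p)))))))

  -- The lexicographic order and the induction

  x y : V → Carrier
  x v = proj₁ (pt v)
  y v = proj₂ (pt v)

  infix 4 _≤ₗ_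
  _≤ₗ_ : V → V → Set (ℓ₁ ⊔ ℓ₂)
  u ≤ₗ v = Pos (x v - x u) ⊎ (x v - x u ≈ 0# × NonNeg (y v - y u))

  ≤ₗ-total : ∀ u v → u ≤ₗ v ⊎ v ≤ₗ u
  ≤ₗ-total u v with sign (x v - x u)
  ... | pos p = inj₁ (inj₁ p)
  ... | neg p = inj₂ (inj₁ (pos-resp (neg-swap (x v) (x u)) p))
  ... | zer e with nonNeg-total (y v) (y u)
  ...   | inj₁ p = inj₁ (inj₂ (e , p))
  ...   | inj₂ p = inj₂ (inj₂ (trans (sym (neg-swap (x v) (x u))) (-zero e) , p))

  ≤ₗ-trans : ∀ u v w → u ≤ₗ v → v ≤ₗ w → u ≤ₗ w
  ≤ₗ-trans u v w = go
    where
    step : ∀ {a b c} → (c - b) + (b - a) ≈ c - a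
    step {a} {b} {c} = solve 3 (λ a b c → (c :- b) :+ (b :- a) := c :- a) a b c
    go : u ≤ₗ v → v ≤ₗ w → u ≤ₗ w
    go (inj₁ p) (inj₁ q) = inj₁ (pos-resp step (pos-+ q p))
    go (inj₁ p) (inj₂ (e , _)) = inj₁ (pos-resp step (pos-resp (+-comm _ _) (pos-+-nonNeg p (inj₂ e))))
    go (inj₂ (e , _)) (inj₁ q) = inj₁ (pos-resp step (pos-+-nonNeg q (inj₂ e)))
    go (inj₂ (e , p)) (inj₂ (e' , q)) = inj₂ (trans (sym step) (zero-+ e' e) , nonNeg-trans q p)

  -- No vertex lies to the left of `p` or below it on its vertical line. That line, turned slightly
  -- about `p`, then leaves every other vertex strictly on one side; the functional is
  -- `K (x - x p) + (y - y p)` with `K` large.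
  supporting : ∀ p vs → p ∉ vs → (∀ {v} → v ∈ vs → p ≤ₗ v) →
    ∃ λ h → h ⟪ p ⟫ ≈ 0# × (∀ {v} → v ∈ vs → Pos (h ⟪ v ⟫))
  supporting p vs p∉ p≤ = h , h-p , λ v∈ → h-vs v∈ (p≤ v∈)
    where
    dx = offset abscissa (x p)
    dy = offset ordinate (y p)
    dx-eval : ∀ v → dx ⟪ v ⟫ ≈ x v - x p
    dx-eval v = trans (offset-⟨$⟩ abscissa (x p) (pt v)) (+-congʳ (abscissa-⟨$⟩ (pt v)))
    dy-eval : ∀ v → dy ⟪ v ⟫ ≈ y v - y p
    dy-eval v = trans (offset-⟨$⟩ ordinate (y p) (pt v)) (+-congʳ (ordinate-⟨$⟩ (pt v)))
    open Refinement pt dx dy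
    h = proj₁ (refine (p ∷ vs))
    refines : ∀ {v} → v ∈ p ∷ vs → Refines h v
    refines = proj₂ (refine (p ∷ vs))
    h-p : h ⟪ p ⟫ ≈ 0#
    h-p = trans (on-zero (refines (here ≡.refl)) (trans (dx-eval p) (-‿inverseʳ _))) (trans (dy-eval p) (-‿inverseʳ _))
    h-vs : ∀ {v} → v ∈ vs → p ≤ₗ v → Pos (h ⟪ v ⟫)
    h-vs {v} v∈ (inj₁ px) = on-pos (refines (there v∈)) (pos-resp (sym (dx-eval v)) px)
    h-vs {v} v∈ (inj₂ (ex , inj₁ py)) = pos-resp
      (sym (trans (on-zero (refines (there v∈)) (trans (dx-eval v) ex)) (dy-eval v))) py
    h-vs {v} v∈ (inj₂ (ex , inj₂ ey)) = ⊥-elim (p∉ (≡.subst (_∈ vs) (pt-injective (x-y≈0⇒x≈y ex , x-y≈0⇒x≈y ey)) v∈))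

  claim-resp-↭ : ∀ {us vs} → us ↭ vs → Claim vs → Claim us
  claim-resp-↭ us↭vs claim unique convex ¬col k enough = weaken (∈-resp-↭ (↭-sym us↭vs)) ℕₚ.≤-refl
    (claim (unique-resp-↭ us↭vs unique) (convex-resp (∈-resp-↭ us↭vs) (∈-resp-↭ (↭-sym us↭vs)) convex)
      (λ col → ¬col (col-⊆ (∈-resp-↭ us↭vs) col)) k (λ d → ≡.subst (suc k ℕ.≤_) (count-↭ d us↭vs) (enough d)))

  -- The parts of a split are new lists and not tails of the given one, hence the induction on a
  -- bound `N` for the length. Permuting the list brings the corner `p` and its neighbour `q` to the
  -- front.
  claim : ∀ N vs → length vs ℕ.≤ N → Claim vs
  claim N [] _ _ _ ¬col _ _ = ⊥-elim (¬col λ ())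
  claim (suc N) (v ∷ vs) (s≤s len) = from-minimum (Lexicographic.extractMin v vs (All.universal (λ _ → ≡.refl) (v ∷ vs)))
    where
    module Lexicographic = TotalPreorder {A = V} (λ v → v ≡ v) _≤ₗ_
      (λ {u} {v} _ _ → ≤ₗ-total u v) (λ {u} {v} {w} _ _ _ → ≤ₗ-trans u v w)
    IH : ∀ {us} → v ∷ vs ↭ us → ∀ ws → length ws ℕ.< length us → Claim ws
    IH perm ws lt = claim N ws (ℕₚ.≤-trans (ℕₚ.≤-pred (≡.subst (length ws ℕ.<_) (≡.sym (↭-length perm)) lt)) len)

    from-minimum : (∃ λ p → ∃ λ rest → v ∷ vs ↭ p ∷ rest × All (p ≤ₗ_) rest) → Claim (v ∷ vs)
    from-minimum (p , [] , perm , _) = claim-resp-↭ perm λ _ _ ¬col →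
      ⊥-elim (¬col λ { (here ≡.refl) (here ≡.refl) _ → orient-ppq (pt p) _ })
    from-minimum (p , r ∷ rest , perm , p≤) = claim-resp-↭ perm λ unique →
      from-support (supporting p (r ∷ rest)
        (λ p∈ → All.lookup (AllPairs.head unique) p∈ ≡.refl) (All.lookup p≤)) unique
      where
      from-support : (∃ λ h → h ⟪ p ⟫ ≈ 0# × (∀ {v} → v ∈ r ∷ rest → Pos (h ⟪ v ⟫))) → Claim (p ∷ r ∷ rest)
      from-support (h , h-p , h-rest) = from-ray (Around.extractMin r rest (All.tabulate ahead))
        where
        open Angular true (λ v → - linear h v)
        ahead : ∀ {v} → v ∈ r ∷ rest → Pos (linear h (vec (pt p) (pt v)))
        ahead v∈ = pos-resp (sym (trans (linear-vec h _ _) (trans (+-congˡ (-zero h-p)) (+-identityʳ _)))) (h-rest v∈)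
        module Around = TotalPreorder (λ v → Pos (linear h (vec (pt p) (pt v))))
          (λ u v → vec (pt p) (pt u) ⊑ vec (pt p) (pt v))
          (λ {u} {v} _ _ → ⊑-total (vec (pt p) (pt u)) (vec (pt p) (pt v))) (λ a b c → ⊑-trans h a b c)
        from-ray : (∃ λ q → ∃ λ rs → r ∷ rest ↭ q ∷ rs ×
                     All (λ v → vec (pt p) (pt q) ⊑ vec (pt p) (pt v)) rs) → Claim (p ∷ r ∷ rest)
        from-ray (q , rs , perm' , q≼) = claim-resp-↭ (prep p perm') λ unique convex ¬col k enough →
          Sweep.draw unique convex ¬col (IH (↭-trans perm (prep p perm'))) k enough h h-p
            (λ v∈ → h-rest (∈-resp-↭ (↭-sym perm') v∈)) (All.lookup q≼)

  -- The whole vertex set and the theorem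

  vertices : List V
  vertices = map inj₁ (allFin n) ++ map inj₂ (allFin n)

  vertices-complete : ∀ v → v ∈ vertices
  vertices-complete (inj₁ i) = ∈-++⁺ˡ (∈-map⁺ inj₁ (∈-allFin i))
  vertices-complete (inj₂ j) = ∈-++⁺ʳ (map inj₁ (allFin n)) (∈-map⁺ inj₂ (∈-allFin j))

  vertices-unique : Unique vertices
  vertices-unique = Uniqueₚ.++⁺ (Uniqueₚ.map⁺ Sum.inj₁-injective (Uniqueₚ.allFin⁺ n))
    (Uniqueₚ.map⁺ Sum.inj₂-injective (Uniqueₚ.allFin⁺ n)) λ (v∈ , v∈') → distinct (∈-map⁻ inj₁ v∈) (∈-map⁻ inj₂ v∈')
    where
    distinct : ∀ {v : V} → (∃ λ i → i ∈ allFin n × v ≡ inj₁ i) → (∃ λ j → j ∈ allFin n × v ≡ inj₂ j) → ⊥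
    distinct (_ , _ , ≡.refl) (_ , _ , ())

  count-vertices : ∀ d → count d vertices ≡ n
  count-vertices d = ≡.trans (count-++ d (map inj₁ (allFin n)) _)
    (≡.trans (≡.cong₂ ℕ._+_ (lefts d (allFin n)) (rights d (allFin n)))
      (≡.trans (total d _) (Listₚ.length-tabulate id)))
    where
    lefts : ∀ d is → count d (map inj₁ is) ≡ indicator d true ℕ.* length is
    lefts d [] = ≡.sym (ℕₚ.*-zeroʳ (indicator d true))
    lefts d (i ∷ is) = ≡.trans (≡.cong (indicator d true ℕ.+_) (lefts d is)) (≡.sym (ℕₚ.*-suc (indicator d true) (length is)))
    rights : ∀ d is → count d (map inj₂ is) ≡ indicator d false ℕ.* length is
    rights d [] = ≡.sym (ℕₚ.*-zeroʳ (indicator d false))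
    rights d (i ∷ is) = ≡.trans (≡.cong (indicator d false ℕ.+_) (rights d is)) (≡.sym (ℕₚ.*-suc (indicator d false) (length is)))
    total : ∀ d l → indicator d true ℕ.* l ℕ.+ indicator d false ℕ.* l ≡ l
    total true l = ≡.trans (ℕₚ.+-identityʳ _) (ℕₚ.+-identityʳ l)
    total false l = ℕₚ.+-identityʳ l

theorem10 : ∀ {c ℓ₁ ℓ₂} (F : OrderedField c ℓ₁ ℓ₂) (n : ℕ)
    (A B : Fin n → Geometry.Point F) →
    Injective _≡_ (Geometry._≈p_ F) A →
    Injective _≡_ (Geometry._≈p_ F) B →
    (∀ i j → ¬ Geometry._≈p_ F (A i) (B j)) →
    ¬ Geometry.Bivis.Collinear F n A B →
    Σ (List (Geometry.Bivis.Edge F n A B)) λ es →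
    Geometry.Bivis.NonCrossingSubgraph F n A B es × (suc n ≤ length es)
-- The empty set is vacuously collinear; for positive `n` both colours occur, as the claim demands.
theorem10 F zero A B _ _ _ ¬collinear = ⊥-elim (¬collinear λ { (inj₁ ()) ; (inj₂ ()) })
theorem10 F n@(suc k) A B A-injective B-injective A≉B ¬collinear = edges , nonCrossing , enough
  where
  open Drawings F n A B A-injective B-injective A≉B
  open Drawing (claim (length vertices) vertices ℕₚ.≤-refl vertices-unique
    (λ {_} {_} {v} _ _ _ → vertices-complete v)
    (λ col → ¬collinear λ u v w → col (vertices-complete u) (vertices-complete v) (vertices-complete w))
    k (λ d → ℕₚ.≤-reflexive (≡.sym (count-vertices d))))
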